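{- Let $p$ be an odd prime, let $F$ be a field of characteristic $p$, and let $t$ be transcendental over $F$. Then the polynomial $x^p-x-t$ is neither solvable in radicals nor solvable in Chebyshev radicals relative to the field $F(t)$.
   Context: For an element $x$ of a ring and an integer $n\ge 0$, the $n$-th Chebyshev power $x^{\copyright n}$ is defined by $x^{\copyright 0}=2$, $x^{\copyright 1}=x$, $x^{\copyright n}=x\,x^{\copyright (n-1)}-x^{\copyright (n-2)}$. Let $P$ be a univariate polynomial with coefficients in a field $F_0$. $P$ is solvable in radicals relative to $F_0$ if there is a tower of fields $F_0\subseteq F_1\subseteq\cdots\subseteq F_n$ such that $P$ factors completely into linear factors over $F_n$ and, for each $0<i\le n$, $F_i=F_{i-1}(r_i)$ with $r_i^{m_i}\in F_{i-1}$ for some positive integer $m_i$. $P$ is solvable in Chebyshev radicals relative to $F_0$ if there is such a tower with $r_i^{m_i}\in F_{i-1}$ replaced by $r_i^{\copyright m_i}\in F_{i-1}$ for some positive integer $m_i$. -}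

module Defs where

open import Algebra.Apartness.Bundles using (HeytingField; HeytingCommutativeRing)
open import Algebra.Bundles using (CommutativeRing)
open import Algebra.Bundles.Raw using (RawRing)
open import Algebra.Morphism.Structures using (IsRingMonomorphism)
import Algebra.Definitions.RawSemiring as RawSemiringDefs
open import Data.List.Base using (List; []; _∷_; foldr; map)
open import Data.Nat.Base using (ℕ; zero; suc; NonZero)
open import Data.Nat.Divisibility using (_∣_)
open import Data.Product.Base using (Σ-syntax; ∃-syntax)
open import Function.Base using (id; _∘_)
open import Function.Bundles using (_⇔_)
open import Level using (Level; _⊔_) renaming (suc to lsuc)

-- A Heyting field is the constructive notion of field: the apartness _#_ is
-- tight and x # y holds exactly when x - y is invertible.  In particular
-- 1# # 0#, and under excluded middle these are the fields of classical algebra,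
-- with _#_ being the negation of _≈_.

rawRing : ∀ {c ℓ₁ ℓ₂} → HeytingField c ℓ₁ ℓ₂ → RawRing c ℓ₁
rawRing K = CommutativeRing.rawRing
  (HeytingCommutativeRing.commutativeRing (HeytingField.heytingCommutativeRing K))

HasCharacteristic : ∀ {c ℓ₁ ℓ₂} → HeytingField c ℓ₁ ℓ₂ → ℕ → Set ℓ₁
HasCharacteristic K p = ∀ (n : ℕ) → (n × 1# ≈ 0#) ⇔ (p ∣ n)
  where
  open RawRing (rawRing K)
  open RawSemiringDefs rawSemiring using (_×_)

module _ {c ℓ} (R : RawRing c ℓ) where
  open RawRing R

  power : Carrier → ℕ → Carrier
  power = RawSemiringDefs._^_ rawSemiring

  chebyshevPower : Carrier → ℕ → Carrier
  chebyshevPower x zero          = 1# + 1#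
  chebyshevPower x (suc zero)    = x
  chebyshevPower x (suc (suc n)) =
    x * chebyshevPower x (suc n) + - chebyshevPower x n

-- A polynomial is the list of its coefficients, constant term first; lists
-- differing by trailing zeros denote the same polynomial, so equality is _≈ᴾ_.

module Polynomials {c ℓ} (R : RawRing c ℓ) where
  open RawRing R

  Poly : Set c
  Poly = List Carrier

  coeff : Poly → ℕ → Carrier
  coeff []      n       = 0#
  coeff (a ∷ f) zero    = a
  coeff (a ∷ f) (suc n) = coeff f n

  infix  4 _≈ᴾ_
  infixl 6 _+ᴾ_ _-ᴾ_
  infixl 7 _*ᴾ_
  infix  8 -ᴾ_
  infixr 8 _^ᴾ_

  _≈ᴾ_ : Poly → Poly → Set ℓ
  f ≈ᴾ g = ∀ n → coeff f n ≈ coeff g n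

  C : Carrier → Poly
  C a = a ∷ []

  X : Poly
  X = 0# ∷ 1# ∷ []

  _+ᴾ_ : Poly → Poly → Poly
  []      +ᴾ g       = g
  (a ∷ f) +ᴾ []      = a ∷ f
  (a ∷ f) +ᴾ (b ∷ g) = (a + b) ∷ (f +ᴾ g)

  -ᴾ_ : Poly → Poly
  -ᴾ_ = map -_

  _-ᴾ_ : Poly → Poly → Poly
  f -ᴾ g = f +ᴾ -ᴾ g

  _*ᴾ_ : Poly → Poly → Poly
  []      *ᴾ g = []
  (a ∷ f) *ᴾ g = map (a *_) g +ᴾ (0# ∷ (f *ᴾ g))

  rawPolynomialRing : RawRing c ℓ
  rawPolynomialRing = record
    { Carrier = Poly
    ; _≈_     = _≈ᴾ_
    ; _+_     = _+ᴾ_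
    ; _*_     = _*ᴾ_
    ; -_      = -ᴾ_
    ; 0#      = []
    ; 1#      = C 1#
    }

  _^ᴾ_ : Poly → ℕ → Poly
  _^ᴾ_ = power rawPolynomialRing

  eval : Poly → Carrier → Carrier
  eval []      x = 0#
  eval (a ∷ f) x = a + x * eval f x

  Splits : Poly → Set (c ⊔ ℓ)
  Splits f = ∃[ a ] ∃[ αs ] f ≈ᴾ C a *ᴾ foldr _*ᴾ_ (C 1#) (map (λ α → X -ᴾ C α) αs)

-- K ⊆ L is represented by an embedding of K into L.

record Extension {a ℓ₁ ℓ₂ b m₁ m₂}
                 (K : HeytingField a ℓ₁ ℓ₂) (L : HeytingField b m₁ m₂)
                 : Set (a ⊔ ℓ₁ ⊔ b ⊔ m₁) where
  field
    ⟦_⟧                : HeytingField.Carrier K → HeytingField.Carrier L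
    isRingMonomorphism : IsRingMonomorphism (rawRing K) (rawRing L) ⟦_⟧

module _ {a ℓ₁ ℓ₂ b m₁ m₂} {K : HeytingField a ℓ₁ ℓ₂} {L : HeytingField b m₁ m₂}
         (E : Extension K L) where
  private module K = HeytingField K
  open HeytingField L
  open Extension E
  private
    module K[X] = Polynomials (rawRing K)
    module L[X] = Polynomials (rawRing L)

  Transcendental : Carrier → Set (a ⊔ ℓ₁ ⊔ m₁)
  Transcendental t =
    ∀ (f : K[X].Poly) → L[X].eval (map ⟦_⟧ f) t ≈ 0# → f K[X].≈ᴾ []

  -- The smallest subfield K(r) of L containing K and r.
  data Adjoin (r : Carrier) : Carrier → Set (a ⊔ b ⊔ m₁) where
    base      : ∀ x → Adjoin r ⟦ x ⟧
    generator : Adjoin r r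
    add       : ∀ {x y} → Adjoin r x → Adjoin r y → Adjoin r (x + y)
    neg       : ∀ {x} → Adjoin r x → Adjoin r (- x)
    mul       : ∀ {x y} → Adjoin r x → Adjoin r y → Adjoin r (x * y)
    inv       : ∀ {x y} → Adjoin r x → x * y ≈ 1# → Adjoin r y
    resp      : ∀ {x y} → x ≈ y → Adjoin r x → Adjoin r y

  -- L = K(r)
  GeneratedBy : Carrier → Set (a ⊔ b ⊔ m₁)
  GeneratedBy r = ∀ x → Adjoin r x

module _ {c ℓ₁ ℓ₂ : Level}
         (pow : (R : RawRing c ℓ₁) → RawRing.Carrier R → ℕ → RawRing.Carrier R) where

  record RootAdjunction (K L : HeytingField c ℓ₁ ℓ₂) : Set (c ⊔ ℓ₁) where
    open HeytingField L using (Carrier; _≈_)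
    field
      extension   : Extension K L
      r           : Carrier
      generatedBy : GeneratedBy extension r
      m           : ℕ
      m-nonZero   : NonZero m
      radicand    : HeytingField.Carrier K
      pow-r       : pow (rawRing L) r m ≈ Extension.⟦_⟧ extension radicand

  infixr 5 _∷_
  data Tower (K : HeytingField c ℓ₁ ℓ₂) : HeytingField c ℓ₁ ℓ₂ → Set (lsuc (c ⊔ ℓ₁ ⊔ ℓ₂)) where
    []  : Tower K K
    _∷_ : ∀ {L M} → RootAdjunction K L → Tower L M → Tower K M

  embed : ∀ {K L} → Tower K L → HeytingField.Carrier K → HeytingField.Carrier L
  embed []      = id
  embed (s ∷ T) = embed T ∘ Extension.⟦_⟧ (RootAdjunction.extension s)

  SolvableVia : (K : HeytingField c ℓ₁ ℓ₂) → Polynomials.Poly (rawRing K) →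
                Set (lsuc (c ⊔ ℓ₁ ⊔ ℓ₂))
  SolvableVia K P =
    ∃[ L ] Σ[ T ∈ Tower K L ] Polynomials.Splits (rawRing L) (map (embed T) P)

SolvableInRadicals : ∀ {c ℓ₁ ℓ₂} (K : HeytingField c ℓ₁ ℓ₂) →
                     Polynomials.Poly (rawRing K) → Set (lsuc (c ⊔ ℓ₁ ⊔ ℓ₂))
SolvableInRadicals = SolvableVia power

SolvableInChebyshevRadicals : ∀ {c ℓ₁ ℓ₂} (K : HeytingField c ℓ₁ ℓ₂) →
                              Polynomials.Poly (rawRing K) → Set (lsuc (c ⊔ ℓ₁ ⊔ ℓ₂))
SolvableInChebyshevRadicals = SolvableVia chebyshevPower

{-# OPTIONS --safe #-}
module Submission where

-- Why Xᵖ - X - t is not solvable.  Let Ω be a field over F(t).  The claim is that the existence of a root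
-- can be pushed down any tower of radical extensions S ⊆ S(r), rᵐ ∈ S, of subfields of Ω, provided that
-- the bottom field contains t and all the roots of unity of Ω.  So the bottom field is not F(t) but κ(t),
-- where κ is generated by F and the roots of unity of Ω.
--
-- One step (radical-step).  Let α ∈ S(r) be a root.  If p divides m, then α = αᵖ - t lies in S(rᵖ) because
-- the p-th power map is additive, and rᵖ is a radical of exponent m / p.  If p does not divide m and
-- r is not zero, let e be the degree of r over S.  The norm l of r satisfies lᵐ = (rᵐ)ᵉ, so l / rᵉ is a
-- root of unity, hence in S, and therefore rᵉ ∈ S (pureRelation).  Now e divides m, so p does not
-- divide e, and S(r) is graded by ℤ/e with rⁱ in degree i.  The p-th power map multiplies degrees by p,
-- a unit of ℤ/e, so the degree zero part of the equation αᵖ = α + t says that the degree zero part of α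
-- is a root in S (root-descent).
--
-- The norm comes from an exterior algebra: the product rᵏ⁺ᵉ⁻¹ ∧ ... ∧ rᵏ is multiplied by a scalar l when k
-- increases by one, and when k increases by m each of its e factors is multiplied by rᵐ, whence
-- lᵐ = (rᵐ)ᵉ (norm-power).
--
-- The bottom of the tower (no-root).  By a dimension count t stays transcendental over κ
-- (cyclotomic-transcendental), and if α = f / g with f, g ∈ κ[t], then fᵖ - f gᵖ⁻¹ = t gᵖ, in which the
-- degrees cannot match.
--
-- Chebyshev radicals.  If r = u + v with u v = 1, then the m-th Chebyshev power a of r is uᵐ + vᵐ.
-- After adjoining a root u of X² - r X + 1 to Ω for each generator r of the tower (rootExtension), the
-- extension by r is contained in an extension by two radicals, uᵐ - vᵐ, whose square is a² - 4, and
-- then u (chebyshev-rootless).  Recovering uᵐ from a and uᵐ - vᵐ takes a division by 2, and this is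
-- where p has to be odd.
--
-- The argument uses classical case distinctions.  They are legitimate because the goal is a negation
-- and equality in a Heyting field is stable under double negation; the intermediate statements
-- are made in the double-negation monad.

open import Defs
open import Algebra.Apartness.Bundles using (HeytingField; HeytingCommutativeRing)
open import Algebra.Bundles using (CommutativeRing)
open import Algebra.Bundles.Raw using (RawRing)
import Algebra.Morphism.Construct.Composition as Composition
open import Algebra.Morphism.Construct.Identity using (isRingHomomorphism)
open import Algebra.Morphism.Structures using (IsRingHomomorphism; module RingMorphisms)
import Algebra.Properties.AbelianGroup as AbelianGroupProperties
import Algebra.Properties.CommutativeMonoid.Sum as Sum
import Algebra.Properties.CommutativeSemiring.Binomial as Binomial
import Algebra.Properties.CommutativeSemiring.Exp as CommutativeExp
import Algebra.Properties.Ring as RingProperties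
import Algebra.Properties.Semiring.Exp as Exp
import Algebra.Properties.Semiring.Mult as Mult
import Algebra.Solver.Ring as RingSolver
open import Algebra.Solver.Ring.AlmostCommutativeRing
  using (fromCommutativeRing; _-Raw-AlmostCommutative⟶_; Induced-equivalence)
open import Data.Bool.Base using (Bool; true; false)
open import Data.Empty using (⊥)
open import Data.Fin.Base using (Fin; zero; suc; inject₁; fromℕ)
open import Data.Fin.Properties using (toℕ<n; toℕ-fromℕ; toℕ-inject₁)
open import Data.List.Base using (List; []; _∷_; length; map; foldr; _++_)
open import Data.List.Properties using (map-id; length-++)
open import Data.List.Relation.Unary.All as All using (All; []; _∷_)
open import Data.List.Relation.Unary.All.Properties using (map⁻)
open import Data.Maybe.Base using (Maybe; just; nothing)
open import Data.Nat.Base as ℕ using (ℕ; zero; suc; NonZero; _!; _∸_)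
open import Data.Nat.Combinatorics using (_C_; k![n∸k]!∣n!; nCn≡1)
open import Data.Nat.Combinatorics.Specification using (nCk≡n!/k![n-k]!)
open import Data.Nat.Coprimality using (Coprime; coprime-divisor)
open import Data.Nat.DivMod using (_/_; _%_; m/n*n≡m; m%n<n; m≡m%n+[m/n]*n)
open import Data.Nat.Divisibility using (_∣?_; m%n≡0⇒n∣m; _∣_; divides; ∣⇒≤; ∣-trans; m∣m*n)
open import Data.Nat.Induction using (<-rec)
open import Data.Nat.Primality using (Prime; euclidsLemma; prime⇒nonTrivial; prime⇒irreducible)
import Data.Nat.Properties as ℕ
open import Data.Nat.Properties using (_!*_!≢0)
open import Data.Product.Base using (_×_; _,_; proj₁; proj₂; ∃-syntax; Σ-syntax)
open import Data.Sum.Base using (_⊎_; inj₁; inj₂)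
open import Data.Unit.Base using (⊤; tt)
open import Data.Vec.Base as Vec using (Vec; []; _∷_; replicate)
open import Function.Base using (_∘_; id)
open import Function.Bundles using (Equivalence)
open import Level using (Level; _⊔_; Lift; lift) renaming (suc to lsuc)
open import Relation.Binary.PropositionalEquality as ≡ using (_≡_)
open import Relation.Nullary.Decidable.Core using (yes; no; ¬¬-excluded-middle)
open import Relation.Nullary.Negation using (¬_; contradiction)

-- A ring solver for abstract commutative rings, with integer coefficients

module Solver {c ℓ} (R : CommutativeRing c ℓ) where
  open CommutativeRing R
  open Mult semiring using (×-homo-+; ×1-homo-*) renaming (_×_ to _·_)
  open RingProperties ring
  open import Relation.Binary.Reasoning.Setoid setoid

  -- The pair (m , n) stands for the integer m - n; it is kept in lowest terms, so
  -- that equal integers have equal representations.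
  private
    normal : ℕ → ℕ → ℕ × ℕ
    normal (suc a) (suc b) = normal a b
    normal a       b       = a , b

    integers : RawRing _ _
    integers = record
      { Carrier = ℕ × ℕ
      ; _≈_ = _≡_
      ; _+_ = λ (a , b) (c , d) → normal (a ℕ.+ c) (b ℕ.+ d)
      ; _*_ = λ (a , b) (c , d) → normal (a ℕ.* c ℕ.+ b ℕ.* d) (a ℕ.* d ℕ.+ b ℕ.* c)
      ; -_ = λ (a , b) → b , a
      ; 0# = 0 , 0
      ; 1# = 1 , 0
      }

    ⟦_⟧ : ℕ × ℕ → Carrier
    ⟦ a , b ⟧ = a · 1# - b · 1#

    sub-+ : ∀ a b c d → (a + c) - (b + d) ≈ (a - b) + (c - d)
    sub-+ a b c d = begin
      (a + c) - (b + d)     ≈⟨ +-congˡ (sym (⁻¹-∙-comm b d)) ⟩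
      (a + c) + (- b + - d) ≈⟨ interchange a c (- b) (- d) ⟩
      (a - b) + (c - d)     ∎
      where
      open AbelianGroupProperties +-abelianGroup
      open import Algebra.Properties.CommutativeSemigroup
        (CommutativeRing.+-commutativeSemigroup R) using (interchange)

    sub-* : ∀ a b c d → (a * c + b * d) - (a * d + b * c) ≈ (a - b) * (c - d)
    sub-* a b c d = sym (begin
      (a - b) * (c - d)                         ≈⟨ distribʳ _ _ _ ⟩
      a * (c - d) + - b * (c - d)               ≈⟨ +-cong (distribˡ _ _ _) (distribˡ _ _ _) ⟩
      (a * c + a * - d) + (- b * c + - b * - d) ≈⟨ +-cong (+-congˡ (sym (-‿distribʳ-* a d)))
          (+-cong (sym (-‿distribˡ-* b c)) (trans (sym (-‿distribˡ-* b (- d)))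
             (trans (-‿cong (sym (-‿distribʳ-* b d))) (-‿involutive _)))) ⟩
      (a * c - a * d) + (- (b * c) + b * d)     ≈⟨ +-congˡ (+-comm _ _) ⟩
      (a * c - a * d) + (b * d - b * c)         ≈⟨ sym (sub-+ _ _ _ _) ⟩
      (a * c + b * d) - (a * d + b * c)         ∎)

    equal : ∀ a b c d → a ℕ.+ d ≡ c ℕ.+ b → ⟦ a , b ⟧ ≈ ⟦ c , d ⟧
    equal a b c d eq = begin
      x - y             ≈⟨ sym (+-identityʳ _) ⟩
      (x - y) + 0#      ≈⟨ +-congˡ (sym (-‿inverseʳ w)) ⟩
      (x - y) + (w - w) ≈⟨ sym (sub-+ _ _ _ _) ⟩
      (x + w) - (y + w) ≈⟨ +-congʳ (sym (×-homo-+ 1# a d)) ⟩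
      ((a ℕ.+ d) · 1#) - (y + w) ≈⟨ +-congʳ (reflexive (≡.cong (_· 1#) eq)) ⟩
      ((c ℕ.+ b) · 1#) - (y + w) ≈⟨ +-cong (×-homo-+ 1# c b) (-‿cong (+-comm y w)) ⟩
      (z + y) - (w + y) ≈⟨ sub-+ _ _ _ _ ⟩
      (z - w) + (y - y) ≈⟨ +-congˡ (-‿inverseʳ y) ⟩
      (z - w) + 0#      ≈⟨ +-identityʳ _ ⟩
      z - w             ∎
      where
      x = a · 1#
      y = b · 1#
      z = c · 1#
      w = d · 1#

    ⟦normal⟧ : ∀ a b → ⟦ normal a b ⟧ ≈ a · 1# - b · 1#
    ⟦normal⟧ (suc a) (suc b) = trans (⟦normal⟧ a b) (equal a b (suc a) (suc b) (ℕ.+-suc a b))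
    ⟦normal⟧ zero    zero    = refl
    ⟦normal⟧ zero    (suc b) = refl
    ⟦normal⟧ (suc a) zero    = refl

    morphism : integers -Raw-AlmostCommutative⟶ fromCommutativeRing R
    morphism = record
      { ⟦_⟧ = ⟦_⟧
      ; +-homo = λ (a , b) (c , d) → trans (⟦normal⟧ (a ℕ.+ c) (b ℕ.+ d)) (trans
          (+-cong (×-homo-+ 1# a c) (-‿cong (×-homo-+ 1# b d))) (sub-+ _ _ _ _))
      ; *-homo = λ (a , b) (c , d) → trans (⟦normal⟧ (a ℕ.* c ℕ.+ b ℕ.* d) (a ℕ.* d ℕ.+ b ℕ.* c)) (trans
          (+-cong (trans (×-homo-+ 1# (a ℕ.* c) (b ℕ.* d)) (+-cong (×1-homo-* a c) (×1-homo-* b d)))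
             (-‿cong (trans (×-homo-+ 1# (a ℕ.* d) (b ℕ.* c))
               (+-cong (×1-homo-* a d) (×1-homo-* b c)))))
          (sub-* _ _ _ _))
      ; -‿homo = λ (a , b) → trans (+-comm _ _) (trans (+-congˡ (sym (-‿involutive _)))
          (⁻¹-∙-comm _ _))
      ; 0-homo = -‿inverseʳ 0#
      ; 1-homo = trans (+-cong (+-identityʳ 1#) -0#≈0#) (+-identityʳ 1#)
      }
      where open AbelianGroupProperties +-abelianGroup using (⁻¹-∙-comm)

    _≟_ : ∀ i j → Maybe (Induced-equivalence morphism i j)
    (a , b) ≟ (c , d) with a ℕ.+ d ℕ.≟ c ℕ.+ b
    ... | yes eq = just (equal a b c d eq)
    ... | no  _  = nothing

  open RingSolver integers (fromCommutativeRing R) morphism _≟_ public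
    using (solve; _:=_; _:+_; _:*_; _:-_; :-_)


-- The p-th power map in characteristic p

prime>1 : ∀ {p} → Prime p → 1 ℕ.< p
prime>1 pr = ℕ.nonTrivial⇒n>1 _ ⦃ prime⇒nonTrivial pr ⦄

n∣n! : ∀ n → 1 ℕ.< n → n ∣ n !
n∣n! (suc n) _ = m∣m*n (n !)

prime∤! : ∀ {p} → Prime p → ∀ n → n ℕ.< p → ¬ (p ∣ n !)
prime∤! pr zero    n<p p∣1 = contradiction (∣⇒≤ p∣1) (ℕ.<⇒≱ (prime>1 pr))
prime∤! pr (suc n) n<p p∣n! with euclidsLemma (suc n) (n !) pr p∣n!
... | inj₁ p∣n  = contradiction (∣⇒≤ p∣n) (ℕ.<⇒≱ n<p)
... | inj₂ p∣n! = prime∤! pr n (ℕ.<-trans (ℕ.n<1+n n) n<p) p∣n!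

prime∣C : ∀ {p} → Prime p → ∀ k → 0 ℕ.< k → k ℕ.< p → p ∣ p C k
prime∣C {p} pr k 0<k k<p with euclidsLemma (p C k) (k ! ℕ.* (p ∸ k) !) pr p∣product
  where
  instance
    nonZero : NonZero (k ! ℕ.* (p ∸ k) !)
    nonZero = k !* (p ∸ k) !≢0
  product≡p! : (p C k) ℕ.* (k ! ℕ.* (p ∸ k) !) ≡ p !
  product≡p! = ≡.trans (≡.cong (ℕ._* (k ! ℕ.* (p ∸ k) !)) (nCk≡n!/k![n-k]! (ℕ.<⇒≤ k<p)))
    (m/n*n≡m (k![n∸k]!∣n! (ℕ.<⇒≤ k<p)))
  p∣product : p ∣ (p C k) ℕ.* (k ! ℕ.* (p ∸ k) !)
  p∣product = ≡.subst (p ∣_) (≡.sym product≡p!) (n∣n! p (prime>1 pr))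
... | inj₁ p∣C = p∣C
... | inj₂ p∣k![p-k]! with euclidsLemma (k !) ((p ∸ k) !) pr p∣k![p-k]!
...   | inj₁ p∣k!     = contradiction p∣k! (prime∤! pr k k<p)
...   | inj₂ p∣[p-k]! = contradiction p∣[p-k]! (prime∤! pr (p ∸ k) (∸-< 0<k k<p))
  where
  ∸-< : ∀ {k p} → 0 ℕ.< k → k ℕ.< p → p ∸ k ℕ.< p
  ∸-< {suc k} {suc p} _ _ = ℕ.s≤s (ℕ.m∸n≤m p k)

module Frobenius {c ℓ} (R : CommutativeRing c ℓ) {p : ℕ} (prime : Prime p) where
  open CommutativeRing R
  open Exp semiring using (_^_)
  open Mult semiring using (×-congʳ; ×-assocˡ; ×-assoc-*) renaming (_×_ to _·_)
  open Sum +-commutativeMonoid using (sum; sum-init-last; sum-cong-≋; sum-replicate-zero)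
  open Binomial commutativeSemiring using (binomialTerm; theorem)
  open import Relation.Binary.Reasoning.Setoid setoid

  module _ (p·1≈0 : p · 1# ≈ 0#) where

    p∣n⇒n·x≈0 : ∀ n x → p ∣ n → n · x ≈ 0#
    p∣n⇒n·x≈0 n x (divides q ≡.refl) = begin
      (q ℕ.* p) · x            ≈⟨ ×-congʳ (q ℕ.* p) (sym (*-identityˡ x)) ⟩
      (q ℕ.* p) · (1# * x)     ≈⟨ sym (×-assoc-* (q ℕ.* p) 1# x) ⟩
      ((q ℕ.* p) · 1#) * x     ≈⟨ *-congʳ (sym (×-assocˡ 1# q p)) ⟩
      (q · (p · 1#)) * x       ≈⟨ *-congʳ (×-congʳ q p·1≈0) ⟩
      (q · 0#) * x             ≈⟨ ×-assoc-* q 0# x ⟩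
      q · (0# * x)             ≈⟨ ×-congʳ q (zeroˡ x) ⟩
      q · 0#                   ≈⟨ n·0 q ⟩
      0#                       ∎
      where
      n·0 : ∀ n → n · 0# ≈ 0#
      n·0 zero    = refl
      n·0 (suc n) = trans (+-identityˡ _) (n·0 n)

    frobenius-+ : ∀ x y → (x + y) ^ p ≈ x ^ p + y ^ p
    frobenius-+ x y = begin
      (x + y) ^ p                       ≈⟨ theorem p x y ⟩
      sum (term p)                      ≈⟨ expand p (prime>1 prime) (prime∣C prime) p∣n⇒n·x≈0 ⟩
      y ^ p + x ^ p                     ≈⟨ +-comm _ _ ⟩
      x ^ p + y ^ p                     ∎
      where
      term : ∀ n → Fin (suc n) → Carrier
      term = binomialTerm x y

      expand : ∀ n → 1 ℕ.< n → (∀ k → 0 ℕ.< k → k ℕ.< n → p ∣ n C k) →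
               (∀ n x → p ∣ n → n · x ≈ 0#) → sum (term n) ≈ y ^ n + x ^ n
      expand (suc q) 1<n p∣C vanish = +-cong first
        (trans (sum-init-last (term (suc q) ∘ suc)) (trans (+-cong middle last) (+-identityˡ _)))
        where
        first : (suc q C 0) · (1# * y ^ suc q) ≈ y ^ suc q
        first = trans (+-identityʳ _) (*-identityˡ _)
        middle : sum (λ i → term (suc q) (suc (inject₁ i))) ≈ 0#
        middle = trans (sum-cong-≋ (λ i → vanish _ _ (p∣C _ ℕ.z<s
          (ℕ.s<s (≡.subst (ℕ._< q) (≡.sym (toℕ-inject₁ i)) (toℕ<n i))))))
          (sum-replicate-zero q)
        last : term (suc q) (suc (fromℕ q)) ≈ x ^ suc q
        last rewrite toℕ-fromℕ q | nCn≡1 (suc q) | ℕ.n∸n≡0 q =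
          trans (+-identityʳ _) (*-identityʳ _)

-- Fields with classical logic under double negation

-- Fields for classical reasoning: equality is stable under double negation,
-- and a nonzero element has an inverse up to double negation.
record StableField c ℓ : Set (lsuc (c ⊔ ℓ)) where
  field
    commutativeRing : CommutativeRing c ℓ
  open CommutativeRing commutativeRing public
  field
    ≈-stable : ∀ {x y} → ¬ ¬ (x ≈ y) → x ≈ y
    1≉0      : ¬ (1# ≈ 0#)
    inverse  : ∀ x → ¬ (x ≈ 0#) → ¬ ¬ (∃[ y ] x * y ≈ 1#)

stableField : ∀ {c ℓ₁ ℓ₂} → HeytingField c ℓ₁ ℓ₂ → StableField c ℓ₁
stableField K = record
  { commutativeRing = K-ring
  ; ≈-stable = λ ¬¬x≈y → proj₁ (tight _ _) (λ x#y → ¬¬x≈y (λ x≈y → proj₂ (tight _ _) x≈y x#y))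
  ; 1≉0 = λ 1≈0 → proj₂ (tight _ _) 1≈0 (invertible⇒#
      (1# , trans (*-identityˡ _) 1-0≈1 , trans (*-identityʳ _) 1-0≈1))
  ; inverse = λ x x≉0 ¬inverse → x≉0 (proj₁ (tight _ _) λ x#0 →
      let (y , _ , [x-0]y≈1) = #⇒invertible x#0
      in ¬inverse (y , trans (*-congʳ (sym (x-0≈x x))) [x-0]y≈1))
  }
  where
  K-ring : CommutativeRing _ _
  K-ring = HeytingCommutativeRing.commutativeRing (HeytingField.heytingCommutativeRing K)
  open HeytingField K using (tight; #⇒invertible; invertible⇒#)
  open CommutativeRing K-ring
  x-0≈x : ∀ x → x - 0# ≈ x
  x-0≈x x = trans (+-congˡ (RingProperties.-0#≈0# (CommutativeRing.ring K-ring))) (+-identityʳ x)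
  1-0≈1 = x-0≈x 1#

-- Bind and return of the double-negation monad, at arbitrary universe levels.

infixl 1 _>>=_
_>>=_ : ∀ {a b} {A : Set a} {B : Set b} → ¬ ¬ A → (A → ¬ ¬ B) → ¬ ¬ B
(m >>= f) ¬b = m (λ a → f a ¬b)

pure : ∀ {a} {A : Set a} → A → ¬ ¬ A
pure a ¬a = ¬a a

-- Linear algebra over subfields

module LinearAlgebra {c ℓ} (Ω : StableField c ℓ) (s : Level) where
  open StableField Ω
  open RingProperties ring using (-‿distribˡ-*)
  open Solver commutativeRing
  open import Relation.Binary.Reasoning.Setoid setoid

  open Exp semiring public using (_^_)

  nonzero-* : ∀ {x y} → ¬ (x ≈ 0#) → ¬ (y ≈ 0#) → ¬ (x * y ≈ 0#)
  nonzero-* {x} {y} x≉0 y≉0 xy≈0 = inverse x x≉0 λ (z , xz≈1) → y≉0 (begin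
    y           ≈⟨ sym (*-identityˡ y) ⟩
    1# * y      ≈⟨ *-congʳ (sym xz≈1) ⟩
    x * z * y   ≈⟨ solve 3 (λ x y z → x :* z :* y := z :* (x :* y)) refl x y z ⟩
    z * (x * y) ≈⟨ *-congˡ xy≈0 ⟩
    z * 0#      ≈⟨ zeroʳ z ⟩
    0#          ∎)

  nonzero-^ : ∀ {x} n → ¬ (x ≈ 0#) → ¬ (x ^ n ≈ 0#)
  nonzero-^ zero    x≉0 = 1≉0
  nonzero-^ (suc n) x≉0 = nonzero-* x≉0 (nonzero-^ n x≉0)

  1^n≈1 : ∀ n → 1# ^ n ≈ 1#
  1^n≈1 zero    = refl
  1^n≈1 (suc n) = trans (*-identityˡ _) (1^n≈1 n)

  0^n≈0 : ∀ {n} → 0 ℕ.< n → 0# ^ n ≈ 0#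
  0^n≈0 {suc n} _ = zeroˡ _

  -- Subfields of Ω, as double-negation stable predicates.  The level of the predicate is chosen such
  -- that the subfields constructed below from given ones stay at the same level.
  record Subfield : Set (lsuc (c ⊔ ℓ ⊔ s)) where
    field
      member  : Carrier → Set (c ⊔ ℓ ⊔ s)
      respects    : ∀ {x y} → x ≈ y → member x → member y
      stable  : ∀ {x} → ¬ ¬ member x → member x
      one     : member 1#
      plus    : ∀ {x y} → member x → member y → member (x + y)
      times   : ∀ {x y} → member x → member y → member (x * y)
      negate  : ∀ {x} → member x → member (- x)
      recip   : ∀ {x y} → member x → x * y ≈ 1# → member y

    zero′ : member 0#
    zero′ = respects (-‿inverseʳ 1#) (plus one (negate one))

    pow : ∀ {x} n → member x → member (x ^ n)
    pow zero    x∈S = one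
    pow (suc n) x∈S = times x∈S (pow n x∈S)

  infix 4 _∋_ _⊆_
  _∋_ : Subfield → Carrier → Set (c ⊔ ℓ ⊔ s)
  S ∋ x = Subfield.member S x

  _⊆_ : Subfield → Subfield → Set (c ⊔ ℓ ⊔ s)
  S ⊆ T = ∀ {x} → S ∋ x → T ∋ x

  -- Span S vs x: x is a linear combination of vs with coefficients in S.
  data Span (S : Subfield) : List Carrier → Carrier → Set (c ⊔ ℓ ⊔ s) where
    nil  : ∀ {x} → x ≈ 0# → Span S [] x
    cons : ∀ {v vs x a y} → S ∋ a → Span S vs y → x ≈ a * v + y → Span S (v ∷ vs) x

  -- The powers rⁿ⁻¹, …, r, 1.
  powers : Carrier → ℕ → List Carrier
  powers r zero    = []
  powers r (suc n) = r ^ n ∷ powers r n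

  -- Linear dependence over S, in the form that some element of the list is in the span
  -- of the later ones.
  data Dependent (S : Subfield) : List Carrier → Set (c ⊔ ℓ ⊔ s) where
    here  : ∀ {v vs} → Span S vs v → Dependent S (v ∷ vs)
    there : ∀ {v vs} → Dependent S vs → Dependent S (v ∷ vs)

  span-mono : ∀ {S T vs x} → S ⊆ T → Span S vs x → Span T vs x
  span-mono S⊆T (nil x≈0) = nil x≈0
  span-mono S⊆T (cons a∈S y∈ x≈) = cons (S⊆T a∈S) (span-mono S⊆T y∈) x≈

  module _ {S : Subfield} where
    open Subfield S

    span-resp : ∀ {vs x y} → x ≈ y → Span S vs x → Span S vs y
    span-resp x≈y (nil x≈0)        = nil (trans (sym x≈y) x≈0)
    span-resp x≈y (cons a∈S z∈ x≈) = cons a∈S z∈ (trans (sym x≈y) x≈)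

    span-0 : ∀ {vs} → Span S vs 0#
    span-0 {[]}     = nil refl
    span-0 {v ∷ vs} = cons zero′ span-0 (sym (trans (+-identityʳ _) (zeroˡ v)))

    span-+ : ∀ {vs x y} → Span S vs x → Span S vs y → Span S vs (x + y)
    span-+ (nil x≈0) (nil y≈0) = nil (trans (+-cong x≈0 y≈0) (+-identityˡ _))
    span-+ (cons {v} {_} {_} {a} {x′} a∈S x∈ x≈) (cons {a = b} {y = y′} b∈S y∈ y≈) =
      cons (plus a∈S b∈S) (span-+ x∈ y∈) (trans (+-cong x≈ y≈)
        (solve 5 (λ v a b x y → (a :* v :+ x) :+ (b :* v :+ y) := (a :+ b) :* v :+ (x :+ y))
          refl v a b x′ y′))

    span-* : ∀ {vs b x} → S ∋ b → Span S vs x → Span S vs (b * x)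
    span-* b∈S (nil x≈0) = nil (trans (*-congˡ x≈0) (zeroʳ _))
    span-* {b = b} b∈S (cons {v} {_} {_} {a} {x′} a∈S x∈ x≈) =
      cons (times b∈S a∈S) (span-* b∈S x∈) (trans (*-congˡ x≈)
        (solve 4 (λ b a v x → b :* (a :* v :+ x) := (b :* a) :* v :+ b :* x) refl b a v x′))

    span-neg : ∀ {vs x} → Span S vs x → Span S vs (- x)
    span-neg x∈ = span-resp (trans (sym (-‿distribˡ-* 1# _)) (-‿cong (*-identityˡ _)))
      (span-* (negate one) x∈)

    span-weaken : ∀ {v vs x} → Span S vs x → Span S (v ∷ vs) x
    span-weaken x∈ = cons zero′ x∈ (sym (trans (+-congʳ (zeroˡ _)) (+-identityˡ _)))

    span-head : ∀ {v vs} → Span S (v ∷ vs) v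
    span-head = cons one span-0 (sym (trans (+-identityʳ _) (*-identityˡ _)))

    span-self : ∀ vs → All (Span S vs) vs
    span-self []       = []
    span-self (v ∷ vs) = span-head ∷ All.map span-weaken (span-self vs)

    span-mul : ∀ {vs ws x} y → All (λ v → Span S ws (y * v)) vs → Span S vs x → Span S ws (y * x)
    span-mul y []          (nil x≈0) = span-resp (sym (trans (*-congˡ x≈0) (zeroʳ y))) span-0
    span-mul y (yv∈ ∷ yvs∈) (cons {v} {_} {_} {a} {z} a∈S z∈ x≈) =
      span-resp (trans (solve 4 (λ y a v z → a :* (y :* v) :+ y :* z := y :* (a :* v :+ z)) refl y a v z)
                  (*-congˡ (sym x≈)))
        (span-+ (span-* a∈S yv∈) (span-mul y yvs∈ z∈))

    span-trans : ∀ {vs ws x} → All (Span S ws) vs → Span S vs x → Span S ws x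
    span-trans vs⊆ x∈ = span-resp (*-identityˡ _)
      (span-mul 1# (All.map (span-resp (sym (*-identityˡ _))) vs⊆) x∈)

    span-product : ∀ {vs us ws x y} → All (λ v → All (λ u → Span S ws (v * u)) us) vs →
                   Span S vs x → Span S us y → Span S ws (x * y)
    span-product {x = x} {y} vus∈ x∈ y∈ = span-resp (*-comm y x) (span-mul y
      (All.map (λ {v} vu∈ → span-resp (*-comm v y) (span-mul v vu∈ y∈)) vus∈) x∈)

    -- One step of Gaussian elimination.  Either v is not needed for spanning ws, or some
    -- combination q of ws is congruent to v modulo the span of vs; subtracting
    -- multiples of q eliminates v from the others.
    record Pivot (v : Carrier) (vs ws : List Carrier) : Set (c ⊔ ℓ ⊔ s) where
      field
        pivot     : Carrier
        pivot∈    : Span S ws pivot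
        pivot≡v   : Span S vs (pivot - v)
        rest      : List Carrier
        length≡   : suc (length rest) ≡ length ws
        rest∈vs   : All (Span S vs) rest
        rest∈ws   : All (Span S ws) rest
        dependent : Dependent S rest → Dependent S ws

    eliminate : ∀ {v vs} ws → All (Span S (v ∷ vs)) ws → ¬ ¬ (All (Span S vs) ws ⊎ Pivot v vs ws)
    eliminate [] [] = pure (inj₁ [])
    eliminate {v} {vs} (w ∷ ws) (cons {a = a} {y = y} a∈S y∈ w≈ ∷ ws∈) = eliminate ws ws∈ >>= λ where
      (inj₂ P) → let open Pivot P in pure (inj₂ record
        { pivot     = pivot
        ; pivot∈    = span-weaken pivot∈
        ; pivot≡v   = pivot≡v
        ; rest      = w - a * pivot ∷ rest
        ; length≡   = ≡.cong suc length≡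
        ; rest∈vs   = span-resp
            (trans (solve 4 (λ y a q v → y :- a :* (q :- v) := (a :* v :+ y) :- a :* q) refl y a pivot v)
              (+-congʳ (sym w≈)))
            (span-+ y∈ (span-neg (span-* a∈S pivot≡v))) ∷ rest∈vs
        ; rest∈ws   = span-+ span-head (span-neg (span-* a∈S (span-weaken pivot∈)))
                      ∷ All.map span-weaken rest∈ws
        ; dependent = λ where
            (here w-aq∈) → here (span-resp
              (solve 3 (λ w a q → (w :- a :* q) :+ a :* q := w) refl w a pivot)
              (span-+ (span-trans rest∈ws w-aq∈) (span-* a∈S pivot∈)))
            (there d)    → there (dependent d)
        })
      (inj₁ all) → ¬¬-excluded-middle >>= λ where
        (yes a≈0) → pure (inj₁ (span-resp (sym (trans w≈ (trans (+-congʳ (trans (*-congʳ a≈0) (zeroˡ v)))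
          (+-identityˡ y)))) y∈ ∷ all))
        (no a≉0)  → inverse a a≉0 >>= λ (b , ab≈1) → pure (inj₂ record
          { pivot     = b * w
          ; pivot∈    = span-* (recip a∈S ab≈1) span-head
          ; pivot≡v   = span-resp (sym (begin
              b * w - v               ≈⟨ +-congʳ (*-congˡ w≈) ⟩
              b * (a * v + y) - v     ≈⟨ solve 4 (λ a b v y → b :* (a :* v :+ y) :- v
                                           := (a :* b) :* v :- v :+ b :* y) refl a b v y ⟩
              (a * b) * v - v + b * y ≈⟨ +-congʳ (+-congʳ (trans (*-congʳ ab≈1) (*-identityˡ v))) ⟩
              v - v + b * y           ≈⟨ +-congʳ (-‿inverseʳ v) ⟩
              0# + b * y              ≈⟨ +-identityˡ _ ⟩
              b * y                   ∎)) (span-* (recip a∈S ab≈1) y∈)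
          ; rest      = ws
          ; length≡   = ≡.refl
          ; rest∈vs   = all
          ; rest∈ws   = All.map span-weaken (span-self ws)
          ; dependent = there
          })

    -- More elements than there are generators are linearly dependent.
    steinitz : ∀ vs ws → length vs ℕ.< length ws → All (Span S vs) ws → ¬ ¬ Dependent S ws
    steinitz [] (w ∷ ws) _ (nil w≈0 ∷ _) = pure (here (span-resp (sym w≈0) span-0))
    steinitz (v ∷ vs) ws lt ws∈ = eliminate ws ws∈ >>= λ where
      (inj₁ all) → steinitz vs ws (ℕ.<-trans (ℕ.n<1+n _) lt) all
      (inj₂ P) → let open Pivot P in
        steinitz vs rest (ℕ.s<s⁻¹ (≡.subst (suc (length vs) ℕ.<_) (≡.sym length≡) lt)) rest∈vs
          >>= λ d → pure (dependent d)

-- Simple extensions of subfields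

module Adjunction {c ℓ} (Ω : StableField c ℓ) (s : Level) where
  open StableField Ω
  open Exp semiring using (^-homo-*)
  open Solver commutativeRing
  open LinearAlgebra Ω s
  open import Relation.Binary.Reasoning.Setoid setoid

  -- The values at r of the polynomials over S of degree less than n.
  Poly : Subfield → Carrier → ℕ → Carrier → Set (c ⊔ ℓ ⊔ s)
  Poly S r n = Span S (powers r n)

  powers-all : ∀ {p} {P : Carrier → Set p} r n → (∀ i → i ℕ.< n → P (r ^ i)) → All P (powers r n)
  powers-all r zero    Pr = []
  powers-all r (suc n) Pr = Pr n (ℕ.n<1+n n) ∷ powers-all r n (λ i i<n → Pr i (ℕ.m<n⇒m<1+n i<n))

  length-powers : ∀ r n → length (powers r n) ≡ n
  length-powers r zero    = ≡.refl
  length-powers r (suc n) = ≡.cong suc (length-powers r n)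

  -- S ∋[ r ] x: x is in the ring S[r].
  infix 4 _∋[_]_
  _∋[_]_ : Subfield → Carrier → Carrier → Set (c ⊔ ℓ ⊔ s)
  S ∋[ r ] x = ∃[ n ] Poly S r n x

  module _ {S : Subfield} {r : Carrier} where
    open Subfield S

    power∈ : ∀ {i n} → i ℕ.< n → Poly S r n (r ^ i)
    power∈ {i} {suc n} i<1+n with ℕ.m<1+n⇒m<n∨m≡n i<1+n
    ... | inj₁ i<n    = span-weaken (power∈ i<n)
    ... | inj₂ ≡.refl = span-head

    poly-mono : ∀ {m n x} → m ℕ.≤ n → Poly S r m x → Poly S r n x
    poly-mono {m} m≤n = span-trans (powers-all r m (λ i i<m → power∈ (ℕ.<-≤-trans i<m m≤n)))

    poly-const : ∀ {a} → S ∋ a → Poly S r 1 a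
    poly-const a∈S = span-resp (*-identityʳ _) (span-* a∈S span-head)

    poly-var : Poly S r 2 r
    poly-var = span-resp (*-identityʳ _) (power∈ (ℕ.n<1+n 1))

    poly-* : ∀ {m n x y} → Poly S r m x → Poly S r n y → Poly S r (m ℕ.+ n) (x * y)
    poly-* {m} {n} = span-product (powers-all r m λ i i<m → powers-all r n λ j j<n →
      span-resp (^-homo-* r i j) (power∈ (ℕ.+-mono-< i<m j<n)))

    ring-resp : ∀ {x y} → x ≈ y → S ∋[ r ] x → S ∋[ r ] y
    ring-resp x≈y (n , x∈) = n , span-resp x≈y x∈

    ring-const : ∀ {a} → S ∋ a → S ∋[ r ] a
    ring-const a∈S = 1 , poly-const a∈S

    ring-+ : ∀ {x y} → S ∋[ r ] x → S ∋[ r ] y → S ∋[ r ] (x + y)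
    ring-+ (m , x∈) (n , y∈) = m ℕ.+ n ,
      span-+ (poly-mono (ℕ.m≤m+n m n) x∈) (poly-mono (ℕ.m≤n+m n m) y∈)

    ring-* : ∀ {x y} → S ∋[ r ] x → S ∋[ r ] y → S ∋[ r ] (x * y)
    ring-* (m , x∈) (n , y∈) = m ℕ.+ n , poly-* x∈ y∈

    ring-neg : ∀ {x} → S ∋[ r ] x → S ∋[ r ] (- x)
    ring-neg (n , x∈) = n , span-neg x∈

    -- x is the value at r of a polynomial of degree n, with nonzero leading coefficient.
    Leading : ℕ → Carrier → Set (c ⊔ ℓ ⊔ s)
    Leading n x = Σ[ a ∈ Carrier ] Σ[ y ∈ Carrier ]
      S ∋ a × ¬ (a ≈ 0#) × Poly S r n y × x ≈ a * r ^ n + y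

    leading : ∀ n {x} → Poly S r n x → ¬ ¬ (x ≈ 0# ⊎ ∃[ k ] k ℕ.< n × Leading k x)
    leading zero (nil x≈0) = pure (inj₁ x≈0)
    leading (suc n) (cons {a = a} {y = y} a∈S y∈ x≈) = ¬¬-excluded-middle >>= λ where
      (no a≉0)  → pure (inj₂ (n , ℕ.n<1+n n , a , y , a∈S , a≉0 , y∈ , x≈))
      (yes a≈0) → leading n (span-resp
          (sym (trans x≈ (trans (+-congʳ (trans (*-congʳ a≈0) (zeroˡ _))) (+-identityˡ y)))) y∈) >>= λ where
        (inj₁ x≈0)           → pure (inj₁ x≈0)
        (inj₂ (k , k<n , l)) → pure (inj₂ (k , ℕ.m<n⇒m<1+n k<n , l))

    -- From here on r satisfies a monic equation of degree m over S.
    module Integral {m} (0<m : 0 ℕ.< m) (integral : Poly S r m (r ^ m)) where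

      powers-integral : ∀ k → Poly S r m (r ^ k)
      powers-integral zero    = power∈ 0<m
      powers-integral (suc k) = span-mul r (powers-all r m step) (powers-integral k)
        where
        step : ∀ i → i ℕ.< m → Poly S r m (r * r ^ i)
        step i i<m with ℕ.m≤n⇒m<n∨m≡n i<m
        ... | inj₁ 1+i<m  = power∈ 1+i<m
        ... | inj₂ ≡.refl = integral

      reduce : ∀ {x} → S ∋[ r ] x → Poly S r m x
      reduce (n , x∈) = span-trans (powers-all r n (λ i _ → powers-integral i)) x∈

      -- The powers of x are dependent, so some power of x is a combination of higher ones;
      -- dividing by the next power expresses y, the inverse of x, as a polynomial in x.
      inverse∈ : ∀ {x y} → S ∋[ r ] x → x * y ≈ 1# → ¬ ¬ (S ∋[ r ] y)
      inverse∈ {x} {y} x∈ xy≈1 = steinitz (powers r m) (ascending 0 (suc m))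
          (≡.subst₂ ℕ._<_ (≡.sym (length-powers r m)) (≡.sym (length-ascending 0 (suc m))) (ℕ.n<1+n m))
          (ascending-all (λ k → reduce (power-ring k)) 0 (suc m))
        >>= λ d → pure (conclude 0 (suc m) d)
        where
        ascending : ℕ → ℕ → List Carrier
        ascending k zero    = []
        ascending k (suc n) = x ^ k ∷ ascending (suc k) n

        length-ascending : ∀ k n → length (ascending k n) ≡ n
        length-ascending k zero    = ≡.refl
        length-ascending k (suc n) = ≡.cong suc (length-ascending (suc k) n)

        ascending-all : ∀ {p} {P : Carrier → Set p} → (∀ i → P (x ^ i)) → ∀ k n → All P (ascending k n)
        ascending-all Px k zero    = []
        ascending-all Px k (suc n) = Px k ∷ ascending-all Px (suc k) n

        power-ring : ∀ k → S ∋[ r ] (x ^ k)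
        power-ring zero    = ring-const one
        power-ring (suc k) = ring-* x∈ (power-ring k)

        cancel : ∀ k z → y ^ k * (x ^ k * z) ≈ z
        cancel zero    z = trans (*-identityˡ _) (*-identityˡ z)
        cancel (suc k) z = begin
          y * y ^ k * (x * x ^ k * z)     ≈⟨ solve 5 (λ x y a b z → y :* a :* (x :* b :* z)
                                               := a :* (b :* ((x :* y) :* z))) refl x y (y ^ k) (x ^ k) z ⟩
          y ^ k * (x ^ k * (x * y * z))   ≈⟨ cancel k _ ⟩
          x * y * z                       ≈⟨ *-congʳ xy≈1 ⟩
          1# * z                          ≈⟨ *-identityˡ z ⟩
          z                               ∎

        higher : ∀ k j n → All (λ v → Poly S r m (y ^ k * v)) (ascending (k ℕ.+ j) n)
        higher k j zero    = []
        higher k j (suc n) = span-resp (sym (trans (*-congˡ (^-homo-* x k j)) (cancel k _)))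
            (reduce (power-ring j))
          ∷ ≡.subst (λ i → All (λ v → Poly S r m (y ^ k * v)) (ascending i n)) (ℕ.+-suc k j)
              (higher k (suc j) n)

        conclude : ∀ k n → Dependent S (ascending k n) → S ∋[ r ] y
        conclude k (suc n) (here x^k∈) = m , span-resp
          (begin
            y * y ^ k * x ^ k      ≈⟨ solve 3 (λ y a b → y :* a :* b := a :* (b :* y)) refl y (y ^ k) (x ^ k) ⟩
            y ^ k * (x ^ k * y)    ≈⟨ cancel k y ⟩
            y                      ∎)
          (span-mul (y ^ suc k)
            (≡.subst (λ i → All (λ v → Poly S r m (y ^ suc k * v)) (ascending i n)) (ℕ.+-identityʳ (suc k))
              (higher (suc k) 0 n)) x^k∈)
        conclude k (suc n) (there d) = conclude (suc k) n d

      -- The field S(r), which is S[r] up to double negation.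
      adjoin : Subfield
      adjoin = record
        { member   = λ x → ¬ ¬ (S ∋[ r ] x)
        ; respects = λ x≈y x∈ → x∈ >>= λ x∈ → pure (ring-resp x≈y x∈)
        ; stable   = λ x∈ → x∈ >>= id
        ; one      = pure (ring-const one)
        ; plus     = λ x∈ y∈ → x∈ >>= λ x∈ → y∈ >>= λ y∈ → pure (ring-+ x∈ y∈)
        ; times    = λ x∈ y∈ → x∈ >>= λ x∈ → y∈ >>= λ y∈ → pure (ring-* x∈ y∈)
        ; negate   = λ x∈ → x∈ >>= λ x∈ → pure (ring-neg x∈)
        ; recip    = λ x∈ xy≈1 → x∈ >>= λ x∈ → inverse∈ x∈ xy≈1
        }

-- Exterior algebras and linear recurrences

module Exterior {c ℓ} (R : CommutativeRing c ℓ) where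
  open CommutativeRing R hiding (zero)
  open Exp semiring using (_^_)
  open RingProperties ring using (-0#≈0#; -‿distribˡ-*; -‿distribʳ-*)
  open Solver R
  open import Relation.Binary.Reasoning.Setoid setoid

  Vector : ℕ → Set c
  Vector n = Fin n → Carrier

  -- An element of the exterior algebra of Rⁿ, by its coordinates with respect to the
  -- wedge products of subsets of the standard basis; a subset is given by its membership bits.
  Λ : ℕ → Set c
  Λ n = Vec Bool n → Carrier

  -- Pointwise equality of vectors and of elements of exterior algebras.
  infix 4 _≋_
  _≋_ : ∀ {A : Set} → (A → Carrier) → (A → Carrier) → Set ℓ
  f ≋ g = ∀ i → f i ≈ g i

  -- Left multiplication by the vector v.  With the exterior algebra of Rⁿ⁺¹ split as Λ ⊕ e₀ ∧ Λ, where Λ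
  -- is that of Rⁿ, it sends x + e₀ ∧ y to v′ ∧ x + e₀ ∧ (v₀ x - v′ ∧ y).
  wedge : ∀ {n} → Vector n → Λ n → Λ n
  wedge v x []          = 0#
  wedge v x (false ∷ b) = wedge (v ∘ suc) (x ∘ (false ∷_)) b
  wedge v x (true ∷ b)  = v zero * x (false ∷ b) - wedge (v ∘ suc) (x ∘ (true ∷_)) b

  -- The element 1 of degree zero.
  unit : ∀ {n} → Λ n
  unit []          = 1#
  unit (false ∷ b) = unit b
  unit (true ∷ b)  = 0#

  wedge-cong : ∀ {n} {v w : Vector n} {x y : Λ n} → v ≋ w → x ≋ y → wedge v x ≋ wedge w y
  wedge-cong v≋w x≋y []          = refl
  wedge-cong v≋w x≋y (false ∷ b) = wedge-cong (v≋w ∘ suc) (x≋y ∘ (false ∷_)) b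
  wedge-cong v≋w x≋y (true ∷ b)  = +-cong (*-cong (v≋w zero) (x≋y (false ∷ b)))
    (-‿cong (wedge-cong (v≋w ∘ suc) (x≋y ∘ (true ∷_)) b))

  wedge-scaleˡ : ∀ {n} a (v : Vector n) (x : Λ n) → wedge (λ i → a * v i) x ≋ λ b → a * wedge v x b
  wedge-scaleˡ a v x []          = sym (zeroʳ a)
  wedge-scaleˡ a v x (false ∷ b) = wedge-scaleˡ a (v ∘ suc) _ b
  wedge-scaleˡ a v x (true ∷ b)  = trans (+-congˡ (-‿cong (wedge-scaleˡ a (v ∘ suc) _ b)))
    (solve 4 (λ a v x w → a :* v :* x :- a :* w := a :* (v :* x :- w)) refl a (v zero) _ _)

  wedge-scaleʳ : ∀ {n} a (v : Vector n) (x : Λ n) → wedge v (λ b → a * x b) ≋ λ b → a * wedge v x b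
  wedge-scaleʳ a v x []          = sym (zeroʳ a)
  wedge-scaleʳ a v x (false ∷ b) = wedge-scaleʳ a (v ∘ suc) _ b
  wedge-scaleʳ a v x (true ∷ b)  = trans (+-congˡ (-‿cong (wedge-scaleʳ a (v ∘ suc) _ b)))
    (solve 4 (λ a v x w → v :* (a :* x) :- a :* w := a :* (v :* x :- w)) refl a (v zero) _ _)

  wedge-+ˡ : ∀ {n} (v w : Vector n) (x : Λ n) →
             wedge (λ i → v i + w i) x ≋ λ b → wedge v x b + wedge w x b
  wedge-+ˡ v w x []          = sym (+-identityˡ 0#)
  wedge-+ˡ v w x (false ∷ b) = wedge-+ˡ (v ∘ suc) (w ∘ suc) _ b
  wedge-+ˡ v w x (true ∷ b)  = trans (+-congˡ (-‿cong (wedge-+ˡ (v ∘ suc) (w ∘ suc) _ b)))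
    (solve 5 (λ v w x p q → (v :+ w) :* x :- (p :+ q) := (v :* x :- p) :+ (w :* x :- q))
      refl (v zero) (w zero) _ _ _)

  wedge-0ˡ : ∀ {n} (x : Λ n) → wedge (λ _ → 0#) x ≋ λ _ → 0#
  wedge-0ˡ x b = trans (wedge-cong (λ _ → sym (zeroˡ 0#)) (λ _ → refl) b)
    (trans (wedge-scaleˡ 0# (λ _ → 0#) x b) (zeroˡ _))

  wedge-0ʳ : ∀ {n} (v : Vector n) → wedge v (λ _ → 0#) ≋ λ _ → 0#
  wedge-0ʳ v b = trans (wedge-cong {v = v} (λ _ → refl) (λ _ → sym (zeroˡ 0#)) b)
    (trans (wedge-scaleʳ 0# v (λ _ → 0#) b) (zeroˡ _))

  wedge-combineʳ : ∀ {n} (v : Vector n) a (x y : Λ n) →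
                   wedge v (λ b → a * x b - y b) ≋ λ b → a * wedge v x b - wedge v y b
  wedge-combineʳ v a x y []          = sym (trans (+-cong (zeroʳ a) -0#≈0#) (+-identityˡ 0#))
  wedge-combineʳ v a x y (false ∷ b) = wedge-combineʳ (v ∘ suc) a _ _ b
  wedge-combineʳ v a x y (true ∷ b)  =
    trans (+-congˡ (-‿cong (wedge-combineʳ (v ∘ suc) a (x ∘ (true ∷_)) (y ∘ (true ∷_)) b)))
      (solve 6 (λ v a x y p q → v :* (a :* x :- y) :- (a :* p :- q) := a :* (v :* x :- p) :- (v :* y :- q))
        refl (v zero) a _ _ _ _)

  wedge-self : ∀ {n} (v : Vector n) (x : Λ n) → wedge v (wedge v x) ≋ λ _ → 0#
  wedge-self v x []          = refl
  wedge-self v x (false ∷ b) = wedge-self (v ∘ suc) _ b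
  wedge-self v x (true ∷ b)  = begin
    a * w - wedge v′ (λ b → a * x₀ b - wedge v′ x₁ b) b
      ≈⟨ +-congˡ (-‿cong (wedge-combineʳ v′ a x₀ (wedge v′ x₁) b)) ⟩
    a * w - (a * w - wedge v′ (wedge v′ x₁) b)  ≈⟨ solve 3 (λ a w y → a :* w :- (a :* w :- y) := y) refl a w _ ⟩
    wedge v′ (wedge v′ x₁) b                    ≈⟨ wedge-self v′ x₁ b ⟩
    0#                                          ∎
    where
    a = v zero
    v′ = v ∘ suc
    x₀ = x ∘ (false ∷_)
    x₁ = x ∘ (true ∷_)
    w = wedge v′ x₀ b

  wedge-swap : ∀ {n} (v w : Vector n) (x : Λ n) →
               wedge v (wedge w x) ≋ λ b → - wedge w (wedge v x) b
  wedge-swap v w x []          = sym -0#≈0#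
  wedge-swap v w x (false ∷ b) = wedge-swap (v ∘ suc) (w ∘ suc) _ b
  wedge-swap v w x (true ∷ b)  = begin
    v₀ * wedge w′ x₀ b - wedge v′ (λ b → w₀ * x₀ b - wedge w′ x₁ b) b
      ≈⟨ +-congˡ (-‿cong (wedge-combineʳ v′ w₀ x₀ (wedge w′ x₁) b)) ⟩
    v₀ * wedge w′ x₀ b - (w₀ * wedge v′ x₀ b - wedge v′ (wedge w′ x₁) b)
      ≈⟨ +-congˡ (-‿cong (+-congˡ (-‿cong (wedge-swap v′ w′ x₁ b)))) ⟩
    v₀ * wedge w′ x₀ b - (w₀ * wedge v′ x₀ b - - wedge w′ (wedge v′ x₁) b)
      ≈⟨ solve 5 (λ v w x y z → v :* x :- (w :* y :- (:- z)) := :- (w :* y :- (v :* x :- z)))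
           refl v₀ w₀ _ _ _ ⟩
    - (w₀ * wedge v′ x₀ b - (v₀ * wedge w′ x₀ b - wedge w′ (wedge v′ x₁) b))
      ≈⟨ sym (-‿cong (+-congˡ (-‿cong (wedge-combineʳ w′ v₀ x₀ (wedge v′ x₁) b)))) ⟩
    - (w₀ * wedge v′ x₀ b - wedge w′ (λ b → v₀ * x₀ b - wedge v′ x₁ b) b) ∎
    where
    v₀ = v zero
    w₀ = w zero
    v′ = v ∘ suc
    w′ = w ∘ suc
    x₀ = x ∘ (false ∷_)
    x₁ = x ∘ (true ∷_)

  -- The product V (k + n - 1) ∧ … ∧ V k ∧ x.
  window : ∀ {e} → (ℕ → Vector e) → ℕ → ℕ → Λ e → Λ e
  window V k zero    x = x
  window V k (suc n) x = wedge (V (k ℕ.+ n)) (window V k n x)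

  window-cong : ∀ {e} {U V : ℕ → Vector e} {x y} j k n →
    (∀ i → i ℕ.< n → U (j ℕ.+ i) ≋ V (k ℕ.+ i)) → x ≋ y → window U j n x ≋ window V k n y
  window-cong j k zero    U≋V x≋y = x≋y
  window-cong j k (suc n) U≋V x≋y =
    wedge-cong (U≋V n (ℕ.n<1+n n)) (window-cong j k n (λ i i<n → U≋V i (ℕ.m<n⇒m<1+n i<n)) x≋y)

  window-scale : ∀ {e} (V : ℕ → Vector e) a k n x →
    window (λ i j → a * V i j) k n x ≋ λ b → a ^ n * window V k n x b
  window-scale V a k zero    x b = sym (*-identityˡ _)
  window-scale V a k (suc n) x b = begin
    wedge (λ j → a * v j) (window (λ i j → a * V i j) k n x) b ≈⟨ wedge-scaleˡ a v _ b ⟩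
    a * wedge v (window (λ i j → a * V i j) k n x) b
      ≈⟨ *-congˡ (wedge-cong {v = v} (λ _ → refl) (window-scale V a k n x) b) ⟩
    a * wedge v (λ b → a ^ n * window V k n x b) b   ≈⟨ *-congˡ (wedge-scaleʳ (a ^ n) v _ b) ⟩
    a * (a ^ n * wedge v (window V k n x) b)         ≈⟨ sym (*-assoc _ _ _) ⟩
    a ^ suc n * window V k (suc n) x b               ∎
    where v = V (k ℕ.+ n)

  window-shift : ∀ {e} (V : ℕ → Vector e) k n x →
    window V k (suc n) x ≋ window V (suc k) n (wedge (V k) x)
  window-shift V k zero    x b rewrite ℕ.+-identityʳ k = refl
  window-shift V k (suc n) x b rewrite ℕ.+-suc k n =
    wedge-cong {v = V (suc (k ℕ.+ n))} (λ _ → refl) (window-shift V k n x) b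

  -- The sign (-1)ⁿ of moving a vector past n others.
  sign : ℕ → Carrier
  sign n = (- 1#) ^ n

  window-move : ∀ {e} (V : ℕ → Vector e) k n v x →
    window V k n (wedge v x) ≋ λ b → sign n * wedge v (window V k n x) b
  window-move V k zero    v x b = sym (*-identityˡ _)
  window-move V k (suc n) v x b = begin
    wedge u (window V k n (wedge v x)) b
      ≈⟨ wedge-cong {v = u} (λ _ → refl) (window-move V k n v x) b ⟩
    wedge u (λ b → sign n * wedge v y b) b ≈⟨ wedge-scaleʳ (sign n) u _ b ⟩
    sign n * wedge u (wedge v y) b         ≈⟨ *-congˡ (wedge-swap u v y b) ⟩
    sign n * - wedge v (wedge u y) b       ≈⟨ sym (-‿distribʳ-* _ _) ⟩
    - (sign n * wedge v (wedge u y) b)     ≈⟨ -‿cong (sym (*-identityˡ _)) ⟩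
    - (1# * (sign n * wedge v (wedge u y) b)) ≈⟨ -‿distribˡ-* _ _ ⟩
    - 1# * (sign n * wedge v (wedge u y) b) ≈⟨ sym (*-assoc _ _ _) ⟩
    sign (suc n) * wedge v (wedge u y) b   ∎
    where
    u = V (k ℕ.+ n)
    y = window V k n x

  window-repeat : ∀ {e} (V : ℕ → Vector e) k n x j → j ℕ.< n →
    wedge (V (k ℕ.+ j)) (window V k n x) ≋ λ _ → 0#
  window-repeat V k (suc n) x j j<1+n b with ℕ.m<1+n⇒m<n∨m≡n j<1+n
  ... | inj₂ ≡.refl = wedge-self (V (k ℕ.+ j)) _ b
  ... | inj₁ j<n    = begin
    wedge v (wedge u y) b   ≈⟨ wedge-swap v u y b ⟩
    - wedge u (wedge v y) b ≈⟨ -‿cong (wedge-cong {v = u} (λ _ → refl) (window-repeat V k n x j j<n) b) ⟩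
    - wedge u (λ _ → 0#) b  ≈⟨ -‿cong (wedge-0ʳ u b) ⟩
    - 0#                    ≈⟨ -0#≈0# ⟩
    0#                      ∎
    where
    v = V (k ℕ.+ j)
    u = V (k ℕ.+ n)
    y = window V k n x

  -- The linear combination a₀ V (k + n - 1) + … + aₙ₋₁ V k.
  combination : ∀ {e} → (ℕ → Vector e) → (n : ℕ) → Vector n → ℕ → Vector e
  combination V zero    a k i = 0#
  combination V (suc n) a k i = a zero * V (k ℕ.+ n) i + combination V n (a ∘ suc) k i

  wedge-combination : ∀ {e} (V : ℕ → Vector e) n a k x →
    (∀ j → 0 ℕ.< j → j ℕ.≤ n → wedge (V (k ℕ.+ j)) x ≋ λ _ → 0#) →
    wedge (combination V (suc n) a k) x ≋ λ b → a (fromℕ n) * wedge (V k) x b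
  wedge-combination V zero a k x kills b rewrite ℕ.+-identityʳ k = trans
    (wedge-cong {x = x} (λ i → +-identityʳ _) (λ _ → refl) b) (wedge-scaleˡ (a zero) (V k) x b)
  wedge-combination V (suc n) a k x kills b = begin
    wedge (combination V (suc (suc n)) a k) x b
      ≈⟨ wedge-+ˡ (λ i → a zero * v i) (combination V (suc n) (a ∘ suc) k) x b ⟩
    wedge (λ i → a zero * v i) x b + wedge (combination V (suc n) (a ∘ suc) k) x b
      ≈⟨ +-cong (trans (wedge-scaleˡ (a zero) v x b) (trans (*-congˡ (kills (suc n) ℕ.z<s ℕ.≤-refl b)) (zeroʳ _)))
           (wedge-combination V n (a ∘ suc) k x (λ j 0<j j≤n → kills j 0<j (ℕ.m≤n⇒m≤1+n j≤n)) b) ⟩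
    0# + a (fromℕ (suc n)) * wedge (V k) x b  ≈⟨ +-identityˡ _ ⟩
    a (fromℕ (suc n)) * wedge (V k) x b       ∎
    where v = V (k ℕ.+ suc n)

  -- The standard basis, in which std n i has a one in position n - 1 - i.
  std : (n : ℕ) → ℕ → Vector n
  std (suc n) i zero with i ℕ.≟ n
  ... | yes _ = 1#
  ... | no  _ = 0#
  std (suc n) i (suc j) = std n i j

  std-top : ∀ n → std (suc n) n zero ≈ 1#
  std-top n with n ℕ.≟ n
  ... | yes _  = refl
  ... | no n≢n = contradiction ≡.refl n≢n

  std-≥ : ∀ n i → n ℕ.≤ i → std n i ≋ λ _ → 0#
  std-≥ (suc n) i n<i zero with i ℕ.≟ n
  ... | yes ≡.refl = contradiction n<i (ℕ.<-irrefl ≡.refl)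
  ... | no _       = refl
  std-≥ (suc n) i n<i (suc j) = std-≥ n i (ℕ.<⇒≤ n<i) j

  window-std : ∀ n → window (std n) 0 n unit (replicate n true) ≈ 1#
  window-std zero    = refl
  window-std (suc n) = begin
    std (suc n) n zero * window (std (suc n)) 0 n unit (false ∷ top) - wedge (std n n) y top
      ≈⟨ +-cong (*-cong (std-top n) (restrict n top))
           (-‿cong (trans (wedge-cong {x = y} (std-≥ n n ℕ.≤-refl) (λ _ → refl) top) (wedge-0ˡ y top))) ⟩
    1# * window (std n) 0 n unit top - 0#  ≈⟨ +-cong (*-congˡ (window-std n)) -0#≈0# ⟩
    1# * 1# + 0#                           ≈⟨ trans (+-identityʳ _) (*-identityˡ _) ⟩
    1#                                     ∎
    where
    top = replicate n true
    y = window (std (suc n)) 0 n unit ∘ (true ∷_)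
    restrict : ∀ k b → window (std (suc n)) 0 k unit (false ∷ b) ≈ window (std n) 0 k unit b
    restrict zero    b = refl
    restrict (suc k) b = wedge-cong {v = std n k} (λ _ → refl) (restrict k) b

  -- If V satisfies a linear recurrence of order e + 1, then each shift of its window of that length
  -- multiplies the window, an analogue of the Casorati determinant, by the last coefficient up to sign.
  module _ {e} (V : ℕ → Vector (suc e)) (a : Vector (suc e))
           (recurrence : ∀ k → V (k ℕ.+ suc e) ≋ combination V (suc e) a k) where

    -- If V k is the vector of coordinates of rᵏ, this is the norm of r.
    norm : Carrier
    norm = sign e * a (fromℕ e)

    window-step : ∀ k → window V (suc k) (suc e) unit ≋ λ b → norm * window V k (suc e) unit b
    window-step k b = begin
      wedge (V (suc k ℕ.+ e)) y b
        ≈⟨ wedge-cong {x = y} (λ i → trans (reflexive (≡.cong (λ j → V j i) (≡.sym (ℕ.+-suc k e))))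
                                (recurrence k i)) (λ _ → refl) b ⟩
      wedge (combination V (suc e) a k) y b  ≈⟨ wedge-combination V e a k y kills b ⟩
      a₀ * wedge (V k) y b                    ≈⟨ *-congˡ (sym (*-identityˡ _)) ⟩
      a₀ * (1# * wedge (V k) y b)             ≈⟨ *-congˡ (*-congʳ (sym (sign² e))) ⟩
      a₀ * (sign e * sign e * wedge (V k) y b) ≈⟨ solve 3 (λ c s w → c :* (s :* s :* w) := s :* c :* (s :* w))
                                                   refl a₀ (sign e) _ ⟩
      norm * (sign e * wedge (V k) y b)      ≈⟨ *-congˡ (sym (trans (window-shift V k e unit b)
                                                  (window-move V (suc k) e (V k) unit b))) ⟩
      norm * window V k (suc e) unit b       ∎
      where
      y = window V (suc k) e unit
      a₀ = a (fromℕ e)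
      kills : ∀ j → 0 ℕ.< j → j ℕ.≤ e → wedge (V (k ℕ.+ j)) y ≋ λ _ → 0#
      kills (suc j) _ j<e rewrite ℕ.+-suc k j = window-repeat V (suc k) e unit j j<e
      sign² : ∀ n → sign n * sign n ≈ 1#
      sign² zero    = *-identityˡ 1#
      sign² (suc n) = trans (solve 2 (λ u s → (:- u) :* s :* ((:- u) :* s) := u :* u :* (s :* s)) refl 1# (sign n))
        (trans (*-cong (*-identityˡ 1#) (sign² n)) (*-identityˡ 1#))

    -- The sequence is multiplied by d in m steps, and so its window of length e + 1 by dᵉ⁺¹.
    norm-power : ∀ {m d} → (∀ i → V (m ℕ.+ i) ≋ λ j → d * V i j) →
                 (∀ i → i ℕ.< suc e → V i ≋ std (suc e) i) → norm ^ m ≈ d ^ suc e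
    norm-power {m} {d} periodic start = begin
      norm ^ m                                  ≈⟨ sym (*-identityʳ _) ⟩
      norm ^ m * 1#                             ≈⟨ *-congˡ (sym first) ⟩
      norm ^ m * window V 0 (suc e) unit top    ≈⟨ sym (iterate m) ⟩
      window V m (suc e) unit top               ≈⟨ window-cong m 0 (suc e) (λ i _ → periodic i) (λ _ → refl) top ⟩
      window (λ i j → d * V i j) 0 (suc e) unit top ≈⟨ window-scale V d 0 (suc e) unit top ⟩
      d ^ suc e * window V 0 (suc e) unit top   ≈⟨ *-congˡ first ⟩
      d ^ suc e * 1#                            ≈⟨ *-identityʳ _ ⟩
      d ^ suc e                                 ∎
      where
      top = replicate (suc e) true
      first : window V 0 (suc e) unit top ≈ 1#
      first = trans (window-cong 0 0 (suc e) start (λ _ → refl) top) (window-std (suc e))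
      iterate : ∀ k → window V k (suc e) unit top ≈ norm ^ k * window V 0 (suc e) unit top
      iterate zero    = sym (*-identityˡ _)
      iterate (suc k) = trans (window-step k top) (trans (*-congˡ (iterate k)) (sym (*-assoc _ _ _)))

-- The norm of an element r of degree e over a subfield

-- The least number principle, under double negation.
least : ∀ {a} {P : ℕ → Set a} n → P n → ¬ ¬ (∃[ k ] k ℕ.≤ n × P k × (∀ j → j ℕ.< k → ¬ P j))
least {P = P} n Pn = below n >>= λ where
    (inj₁ (k , k<n , Pk , min)) → pure (k , ℕ.<⇒≤ k<n , Pk , min)
    (inj₂ none)                 → pure (n , ℕ.≤-refl , Pn , none)
  where
  extend : ∀ {n} → ¬ P n → (∀ j → j ℕ.< n → ¬ P j) → ∀ j → j ℕ.< n ⊎ j ≡ n → ¬ P j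
  extend ¬Pn none j (inj₁ j<n)    = none j j<n
  extend ¬Pn none j (inj₂ ≡.refl) = ¬Pn

  below : ∀ n → ¬ ¬ ((∃[ k ] k ℕ.< n × P k × (∀ j → j ℕ.< k → ¬ P j)) ⊎ (∀ j → j ℕ.< n → ¬ P j))
  below zero    = pure (inj₂ λ _ ())
  below (suc n) = below n >>= λ where
    (inj₁ (k , k<n , Pk , min)) → pure (inj₁ (k , ℕ.m<n⇒m<1+n k<n , Pk , min))
    (inj₂ none) → ¬¬-excluded-middle >>= λ where
      (yes Pn) → pure (inj₁ (n , ℕ.n<1+n n , Pn , none))
      (no ¬Pn) → pure (inj₂ λ j j<1+n → extend ¬Pn none j (ℕ.m<1+n⇒m<n∨m≡n j<1+n))

module Minimal {c ℓ} (Ω : StableField c ℓ) (s : Level)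
               (S : LinearAlgebra.Subfield Ω s) (r : StableField.Carrier Ω) where
  open StableField Ω hiding (zero)
  open Exp semiring using (^-homo-*)
  open RingProperties ring using (-0#≈0#)
  open Solver commutativeRing
  open LinearAlgebra Ω s
  open Adjunction Ω s
  open Exterior commutativeRing using (Vector; _≋_; combination; std; norm; norm-power)
  open Subfield S
  open import Relation.Binary.Reasoning.Setoid setoid

  -- The coefficients of a polynomial in r, leading one first.
  coords : ∀ n {x} → Poly S r n x → Vector n
  coords (suc n) (cons {a = a} _ _ _) zero = a
  coords (suc n) (cons _ y∈ _) (suc i)     = coords n y∈ i

  coords∈ : ∀ n {x} (x∈ : Poly S r n x) i → S ∋ coords n x∈ i
  coords∈ (suc n) (cons a∈S _ _) zero   = a∈S
  coords∈ (suc n) (cons _ y∈ _) (suc i) = coords∈ n y∈ i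

  -- The value at r of the polynomial with the given coefficients, leading one first.
  value : ∀ n → Vector n → Carrier
  value zero    a = 0#
  value (suc n) a = a zero * r ^ n + value n (a ∘ suc)

  value-coords : ∀ n {x} (x∈ : Poly S r n x) → value n (coords n x∈) ≈ x
  value-coords zero    (nil x≈0)      = sym x≈0
  value-coords (suc n) (cons _ y∈ x≈) = trans (+-congˡ (value-coords n y∈)) (sym x≈)

  value∈ : ∀ n a → (∀ i → S ∋ a i) → Poly S r n (value n a)
  value∈ zero    a a∈ = nil refl
  value∈ (suc n) a a∈ = cons (a∈ zero) (value∈ n (a ∘ suc) (a∈ ∘ suc)) refl

  value-linear : ∀ n d (v w : Vector n) → value n (λ i → d * v i + w i) ≈ d * value n v + value n w
  value-linear zero    d v w = sym (trans (+-identityʳ _) (zeroʳ d))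
  value-linear (suc n) d v w = trans (+-congˡ (value-linear n d (v ∘ suc) (w ∘ suc)))
    (solve 6 (λ d v w t x y → (d :* v :+ w) :* t :+ (d :* x :+ y) := d :* (v :* t :+ x) :+ (w :* t :+ y))
      refl d (v zero) (w zero) (r ^ n) _ _)

  value-cong : ∀ n {v w : Vector n} → v ≋ w → value n v ≈ value n w
  value-cong zero    v≋w = refl
  value-cong (suc n) v≋w = +-cong (*-congʳ (v≋w zero)) (value-cong n (v≋w ∘ suc))

  value-0 : ∀ n → value n (λ _ → 0#) ≈ 0#
  value-0 zero    = refl
  value-0 (suc n) = trans (+-cong (zeroˡ _) (value-0 n)) (+-identityˡ 0#)

  value-scale : ∀ n d (v : Vector n) → value n (λ i → d * v i) ≈ d * value n v
  value-scale n d v = begin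
    value n (λ i → d * v i)             ≈⟨ value-cong n (λ i → sym (+-identityʳ _)) ⟩
    value n (λ i → d * v i + 0#)        ≈⟨ value-linear n d v (λ _ → 0#) ⟩
    d * value n v + value n (λ _ → 0#)  ≈⟨ +-congˡ (value-0 n) ⟩
    d * value n v + 0#                  ≈⟨ +-identityʳ _ ⟩
    d * value n v                       ∎

  std∈ : ∀ n i j → S ∋ std n i j
  std∈ (suc n) i zero with i ℕ.≟ n
  ... | yes _ = one
  ... | no  _ = zero′
  std∈ (suc n) i (suc j) = std∈ n i j

  value-std : ∀ n i → i ℕ.< n → value n (std n i) ≈ r ^ i
  value-std (suc n) i i<1+n with i ℕ.≟ n
  ... | yes ≡.refl = trans (+-cong (*-identityˡ _)
                       (trans (value-cong n (Exterior.std-≥ commutativeRing n n ℕ.≤-refl)) (value-0 n))) (+-identityʳ _)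
  ... | no  i≢n    = trans (+-cong (zeroˡ _) (value-std n i (ℕ.≤∧≢⇒< (ℕ.s≤s⁻¹ i<1+n) i≢n))) (+-identityˡ _)

  combination∈ : ∀ {e} (V : ℕ → Vector e) n a k → (∀ i j → S ∋ V i j) → (∀ i → S ∋ a i) →
                 ∀ j → S ∋ combination V n a k j
  combination∈ V zero    a k V∈ a∈ j = zero′
  combination∈ V (suc n) a k V∈ a∈ j =
    plus (times (a∈ zero) (V∈ (k ℕ.+ n) j)) (combination∈ V n (a ∘ suc) k V∈ (a∈ ∘ suc) j)

  value-combination : ∀ {e} (V : ℕ → Vector e) → (∀ i → value e (V i) ≈ r ^ i) →
                      ∀ n a k → value e (combination V n a k) ≈ r ^ k * value n a
  value-combination {e} V val zero    a k = trans (value-0 e) (sym (zeroʳ _))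
  value-combination {e} V val (suc n) a k = begin
    value e (combination V (suc n) a k)
      ≈⟨ value-linear e (a zero) (V (k ℕ.+ n)) (combination V n (a ∘ suc) k) ⟩
    a zero * value e (V (k ℕ.+ n)) + value e (combination V n (a ∘ suc) k)
      ≈⟨ +-cong (*-congˡ (trans (val (k ℕ.+ n)) (^-homo-* r k n))) (value-combination V val n (a ∘ suc) k) ⟩
    a zero * (r ^ k * r ^ n) + r ^ k * value n (a ∘ suc)
      ≈⟨ solve 4 (λ a t u v → a :* (t :* u) :+ t :* v := t :* (a :* u :+ v)) refl (a zero) (r ^ k) (r ^ n) _ ⟩
    r ^ k * value (suc n) a ∎

  -- From here on r satisfies no monic equation of degree less than e over S.
  module _ {e} (minimal : ∀ k → k ℕ.< e → ¬ Poly S r k (r ^ k)) where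

    independent : ∀ n → n ℕ.≤ e → ∀ a → (∀ i → S ∋ a i) → value n a ≈ 0# → ∀ i → a i ≈ 0#
    independent (suc n) n<e a a∈ val≈0 i = ≈-stable (¬¬-excluded-middle >>= λ where
        (no a≉0)  → inverse (a zero) a≉0 >>= λ (b , ab≈1) → contradiction
          (span-resp (begin
            b * - value n (a ∘ suc)         ≈⟨ solve 4 (λ a b t v → b :* (:- v)
                                                 := (a :* b) :* t :- b :* (a :* t :+ v)) refl (a zero) b (r ^ n) _ ⟩
            a zero * b * r ^ n - b * value (suc n) a ≈⟨ +-cong (trans (*-congʳ ab≈1) (*-identityˡ _))
                                                 (trans (-‿cong (trans (*-congˡ val≈0) (zeroʳ b))) -0#≈0#) ⟩
            r ^ n + 0#                      ≈⟨ +-identityʳ _ ⟩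
            r ^ n                           ∎)
            (span-* (recip (a∈ zero) ab≈1) (span-neg (value∈ n (a ∘ suc) (a∈ ∘ suc)))))
          (minimal n n<e)
        (yes a≈0) → pure (rest a≈0 i))
      where
      rest : a zero ≈ 0# → ∀ i → a i ≈ 0#
      rest a≈0 zero    = a≈0
      rest a≈0 (suc i) = independent n (ℕ.<⇒≤ n<e) (a ∘ suc) (a∈ ∘ suc)
        (trans (sym (trans (+-congʳ (trans (*-congʳ a≈0) (zeroˡ _))) (+-identityˡ _))) val≈0) i

    value-injective : ∀ a b → (∀ i → S ∋ a i) → (∀ i → S ∋ b i) → value e a ≈ value e b → a ≋ b
    value-injective a b a∈ b∈ val≈ i = begin
      a i                     ≈⟨ solve 3 (λ u a b → a := b :+ ((:- u) :* b :+ a) :+ (u :* b :- b)) refl 1# (a i) (b i) ⟩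
      b i + (- 1# * b i + a i) + (1# * b i - b i) ≈⟨ +-cong (+-congˡ difference)
                                    (trans (+-congʳ (*-identityˡ _)) (-‿inverseʳ _)) ⟩
      b i + 0# + 0#           ≈⟨ trans (+-identityʳ _) (+-identityʳ _) ⟩
      b i                     ∎
      where
      difference : - 1# * b i + a i ≈ 0#
      difference = independent e ℕ.≤-refl (λ i → - 1# * b i + a i)
        (λ i → plus (times (negate one) (b∈ i)) (a∈ i))
        (trans (value-linear e (- 1#) b a) (trans (+-congˡ val≈)
          (trans (+-congʳ (trans (sym (RingProperties.-‿distribˡ-* ring _ _)) (-‿cong (*-identityˡ _)))) (-‿inverseˡ _)))) i

    -- A constant is not a multiple of r by a polynomial of degree less than e - 1, unless it is zero.
    multiple-constant≈0 : ∀ {e′} → suc e′ ≡ e → ∀ {d y} → Poly S r e′ y → S ∋ d → r * y ≈ d → d ≈ 0#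
    multiple-constant≈0 {e′} ≡.refl {d} {y} y∈ d∈ ry≈d = ≈-stable (leading e′ y∈ >>= λ where
      (inj₁ y≈0) → pure (trans (sym ry≈d) (trans (*-congˡ y≈0) (zeroʳ r)))
      (inj₂ (k , k<e′ , a , z , a∈ , a≉0 , z∈ , y≈)) → inverse a a≉0 >>= λ (b , ab≈1) →
        contradiction
          (span-resp (begin
            b * (d - r * z)                   ≈⟨ *-congˡ (+-congʳ (trans (sym ry≈d) (*-congˡ y≈))) ⟩
            b * (r * (a * r ^ k + z) - r * z) ≈⟨ solve 5 (λ a b r t z → b :* (r :* (a :* t :+ z) :- r :* z)
                                                   := (a :* b) :* (r :* t)) refl a b r (r ^ k) z ⟩
            a * b * r ^ suc k                 ≈⟨ trans (*-congʳ ab≈1) (*-identityˡ _) ⟩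
            r ^ suc k                         ∎)
          (span-* (recip a∈ ab≈1) (span-+ (poly-mono (ℕ.s≤s ℕ.z≤n) (poly-const {r = r} d∈))
            (span-neg (span-mul r (powers-all r k (λ i i<k → power∈ (ℕ.s<s i<k))) z∈)))))
          (minimal (suc k) (ℕ.s<s k<e′)))

  -- The norm l of r; the m-th power of l is the norm of the constant rᵐ.
  norm∈ : ∀ {e} → 0 ℕ.< e → Poly S r e (r ^ e) → (∀ k → k ℕ.< e → ¬ Poly S r k (r ^ k)) →
          ∀ {m} → S ∋ r ^ m → Σ[ l ∈ Carrier ] S ∋ l × l ^ m ≈ (r ^ m) ^ e
  norm∈ {suc e} 0<e integral minimal {m} r^m∈ = norm V a recurrence ,
      times (pow e (negate one)) (V∈ (suc e) (fromℕ e)) ,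
      norm-power V a recurrence {m} periodic initial
    where
    open Integral 0<e integral
    V : ℕ → Vector (suc e)
    V k = coords (suc e) (powers-integral k)
    V∈ : ∀ i j → S ∋ V i j
    V∈ i = coords∈ (suc e) (powers-integral i)
    val : ∀ i → value (suc e) (V i) ≈ r ^ i
    val i = value-coords (suc e) (powers-integral i)
    a : Vector (suc e)
    a = V (suc e)
    recurrence : ∀ k → V (k ℕ.+ suc e) ≋ combination V (suc e) a k
    recurrence k = value-injective minimal _ _ (V∈ (k ℕ.+ suc e)) (combination∈ V (suc e) a k V∈ (V∈ (suc e))) (begin
      value (suc e) (V (k ℕ.+ suc e))         ≈⟨ val (k ℕ.+ suc e) ⟩
      r ^ (k ℕ.+ suc e)                       ≈⟨ ^-homo-* r k (suc e) ⟩
      r ^ k * r ^ suc e                       ≈⟨ *-congˡ (sym (val (suc e))) ⟩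
      r ^ k * value (suc e) a                 ≈⟨ sym (value-combination V val (suc e) a k) ⟩
      value (suc e) (combination V (suc e) a k) ∎)
    periodic : ∀ i → V (m ℕ.+ i) ≋ λ j → r ^ m * V i j
    periodic i = value-injective minimal _ _ (V∈ (m ℕ.+ i)) (λ j → times r^m∈ (V∈ i j)) (begin
      value (suc e) (V (m ℕ.+ i))             ≈⟨ val (m ℕ.+ i) ⟩
      r ^ (m ℕ.+ i)                           ≈⟨ ^-homo-* r m i ⟩
      r ^ m * r ^ i                           ≈⟨ *-congˡ (sym (val i)) ⟩
      r ^ m * value (suc e) (V i)             ≈⟨ sym (value-scale (suc e) (r ^ m) (V i)) ⟩
      value (suc e) (λ j → r ^ m * V i j)     ∎)
    initial : ∀ i → i ℕ.< suc e → V i ≋ std (suc e) i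
    initial i i<1+e = value-injective minimal _ _ (V∈ i) (std∈ (suc e) i)
      (trans (val i) (sym (value-std (suc e) i i<1+e)))

prime∤⇒∣ : ∀ {p} → Prime p → ∀ {e i} → ¬ (p ∣ e) → e ∣ i ℕ.* p → e ∣ i
prime∤⇒∣ {p} pr {e} {i} p∤e e∣ip = coprime-divisor coprime (≡.subst (e ∣_) (ℕ.*-comm i p) e∣ip)
  where
  coprime : Coprime e p
  coprime {d} (d∣e , d∣p) with prime⇒irreducible pr d∣p
  ... | inj₁ d≡1    = d≡1
  ... | inj₂ ≡.refl = contradiction d∣e p∤e

-- Radicals over subfields containing all roots of unity

module Radical {c ℓ} (Ω : StableField c ℓ) (s : Level) where
  open StableField Ω hiding (zero)
  open Exp semiring using (^-congʳ; ^-congˡ; ^-homo-*; ^-assocʳ)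
  open CommutativeExp commutativeSemiring using (^-distrib-*)
  open Solver commutativeRing
  open LinearAlgebra Ω s
  open Adjunction Ω s
  open import Relation.Binary.Reasoning.Setoid setoid

  -- S contains all the roots of unity of Ω.
  RootsOfUnity : Subfield → Set (c ⊔ ℓ ⊔ s)
  RootsOfUnity S = ∀ z n → 0 ℕ.< n → z ^ n ≈ 1# → S ∋ z

  module _ {S : Subfield} where
    open Subfield S

    cancelˡ : ∀ {x y} → S ∋ x → ¬ (x ≈ 0#) → S ∋ x * y → S ∋ y
    cancelˡ {x} {y} x∈ x≉0 xy∈ = stable (inverse x x≉0 >>= λ (z , xz≈1) → pure (respects
      (begin
        z * (x * y) ≈⟨ solve 3 (λ x y z → z :* (x :* y) := (x :* z) :* y) refl x y z ⟩
        x * z * y   ≈⟨ trans (*-congʳ xz≈1) (*-identityˡ y) ⟩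
        y           ∎)
      (times (recip x∈ xz≈1) xy∈)))

    ring-collapse : ∀ {r} → S ∋ r → ∀ {x} → S ∋[ r ] x → S ∋ x
    ring-collapse r∈ (zero , nil x≈0) = respects (sym x≈0) zero′
    ring-collapse r∈ (suc n , cons a∈ y∈ x≈) =
      respects (sym x≈) (plus (times a∈ (pow n r∈)) (ring-collapse r∈ (n , y∈)))

    radical-integral : ∀ {r m} → 0 ℕ.< m → S ∋ r ^ m → Poly S r m (r ^ m)
    radical-integral {r} 0<m r^m∈ = poly-mono 0<m (poly-const {r = r} r^m∈)

    -- The minimal equation of r over S is that rᵉ is in S, where the degree e divides m.
    record PureRelation (r : Carrier) (m : ℕ) : Set (c ⊔ ℓ ⊔ s) where
      field
        degree   : ℕ
        0<degree : 0 ℕ.< degree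
        degree∣m : degree ∣ m
        r^degree∈  : S ∋ r ^ degree
        minimal  : ∀ k → k ℕ.< degree → ¬ Poly S r k (r ^ k)

    pureRelation : RootsOfUnity S → ∀ {r m} → ¬ (r ≈ 0#) → 0 ℕ.< m → S ∋ r ^ m → ¬ ¬ PureRelation r m
    pureRelation μ⊆S {r} {m} r≉0 0<m r^m∈ =
      least {P = λ e → Poly S r e (r ^ e)} m (radical-integral 0<m r^m∈) >>= λ where
        (zero , _ , nil 1≈0 , _)         → contradiction 1≈0 1≉0
        (suc e , e≤m , integral , minimal) → pure (relation e integral minimal)
      where
      relation : ∀ e → Poly S r (suc e) (r ^ suc e) →
                 (∀ k → k ℕ.< suc e → ¬ Poly S r k (r ^ k)) → PureRelation r m
      relation e integral minimal = record
        { degree   = suc e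
        ; 0<degree = ℕ.z<s
        ; degree∣m = m%n≡0⇒n∣m m (suc e) (remainder≡0 (m % suc e) (m%n<n m (suc e)) remainder∈)
        ; r^degree∈  = r^degree∈
        ; minimal  = minimal
        }
        where
        open Minimal Ω s S r

        -- l / rᵉ is a root of unity.
        fromNorm : ∀ l → S ∋ l → l ^ m ≈ (r ^ m) ^ suc e → S ∋ r ^ suc e
        fromNorm l l∈ l^m≈ = stable
          (inverse (r ^ suc e) (nonzero-^ (suc e) r≉0) >>= λ (z , tz≈1) → pure (cancelˡ
            (μ⊆S (l * z) m 0<m (begin
              (l * z) ^ m             ≈⟨ ^-distrib-* l z m ⟩
              l ^ m * z ^ m           ≈⟨ *-congʳ (trans l^m≈ (trans (^-assocʳ r m (suc e))
                                          (trans (^-congʳ r (ℕ.*-comm m (suc e))) (sym (^-assocʳ r (suc e) m))))) ⟩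
              (r ^ suc e) ^ m * z ^ m ≈⟨ sym (^-distrib-* (r ^ suc e) z m) ⟩
              (r ^ suc e * z) ^ m     ≈⟨ ^-congˡ m tz≈1 ⟩
              1# ^ m                  ≈⟨ 1^n≈1 m ⟩
              1#                      ∎))
            (λ lz≈0 → nonzero-* (λ l≈0 → nonzero-^ (suc e) (nonzero-^ m r≉0)
                 (trans (sym l^m≈) (trans (^-congˡ m l≈0) (0^n≈0 0<m))))
               (λ z≈0 → 1≉0 (trans (sym tz≈1) (trans (*-congˡ z≈0) (zeroʳ _)))) lz≈0)
            (respects (begin
              l                     ≈⟨ sym (*-identityʳ l) ⟩
              l * 1#                ≈⟨ *-congˡ (sym tz≈1) ⟩
              l * (r ^ suc e * z)   ≈⟨ solve 3 (λ l t z → l :* (t :* z) := l :* z :* t) refl l (r ^ suc e) z ⟩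
              l * z * r ^ suc e     ∎) l∈)))

        r^degree∈ : S ∋ r ^ suc e
        r^degree∈ = let (l , l∈ , l^m≈) = norm∈ ℕ.z<s integral minimal {m} r^m∈ in fromNorm l l∈ l^m≈

        remainder∈ : S ∋ r ^ (m % suc e)
        remainder∈ = cancelˡ (pow (m / suc e) r^degree∈) (nonzero-^ (m / suc e) (nonzero-^ (suc e) r≉0))
          (respects (begin
            r ^ m                                          ≈⟨ ^-congʳ r (m≡m%n+[m/n]*n m (suc e)) ⟩
            r ^ (m % suc e ℕ.+ (m / suc e) ℕ.* suc e)      ≈⟨ ^-homo-* r (m % suc e) _ ⟩
            r ^ (m % suc e) * r ^ ((m / suc e) ℕ.* suc e)  ≈⟨ *-comm _ _ ⟩
            r ^ ((m / suc e) ℕ.* suc e) * r ^ (m % suc e)  ≈⟨ *-congʳ (trans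
               (^-congʳ r (ℕ.*-comm (m / suc e) (suc e))) (sym (^-assocʳ r (suc e) (m / suc e)))) ⟩
            (r ^ suc e) ^ (m / suc e) * r ^ (m % suc e)    ∎) r^m∈)

        remainder≡0 : ∀ k → k ℕ.< suc e → S ∋ r ^ k → k ≡ 0
        remainder≡0 zero    _    _    = ≡.refl
        remainder≡0 (suc k) k<1+e r^k∈ = contradiction (radical-integral ℕ.z<s r^k∈) (minimal (suc k) k<1+e)

  -- The powers rⁿ, …, r.
  positive : Carrier → ℕ → List Carrier
  positive r zero    = []
  positive r (suc n) = r ^ suc n ∷ positive r n

  module _ {S : Subfield} {r : Carrier} where
    open Subfield S

    positive∈ : ∀ {i n} → 0 ℕ.< i → i ℕ.≤ n → Span S (positive r n) (r ^ i)
    positive∈ {suc i} {suc n} _ i≤n with ℕ.m≤n⇒m<n∨m≡n i≤n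
    ... | inj₁ i<n    = span-weaken (positive∈ ℕ.z<s (ℕ.s<s⁻¹ i<n))
    ... | inj₂ ≡.refl = span-head

    constant-term : ∀ n {x} → Poly S r (suc n) x →
      Σ[ a ∈ Carrier ] Σ[ y ∈ Carrier ] S ∋ a × Span S (positive r n) y × x ≈ a + y
    constant-term zero (cons {a = a} a∈ (nil y≈0) x≈) = a , 0# , a∈ , nil refl ,
      trans x≈ (+-cong (*-identityʳ a) y≈0)
    constant-term (suc n) (cons {a = a} a∈ x∈ x≈) with constant-term n x∈
    ... | b , y , b∈ , y∈ , x≈b+y = b , a * r ^ suc n + y , b∈ , cons a∈ y∈ refl ,
      trans x≈ (trans (+-congˡ x≈b+y) (solve 3 (λ b u y → u :+ (b :+ y) := b :+ (u :+ y)) refl b (a * r ^ suc n) y))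

    -- A combination of rⁿ, …, r is r times a polynomial of degree less than n.
    positive⇒multiple : ∀ n {x} → Span S (positive r n) x → Σ[ y ∈ Carrier ] Poly S r n y × r * y ≈ x
    positive⇒multiple zero (nil x≈0) = 0# , nil refl , trans (zeroʳ r) (sym x≈0)
    positive⇒multiple (suc n) (cons {a = a} a∈ x∈ x≈) with positive⇒multiple n x∈
    ... | y , y∈ , ry≈ = a * r ^ n + y , cons a∈ y∈ refl , sym (trans x≈ (trans (+-congˡ (sym ry≈))
      (solve 4 (λ r a t y → a :* (r :* t) :+ r :* y := r :* (a :* t :+ y)) refl r a (r ^ n) y)))

-- Roots of Xᵖ - X - t in radical extensions

module ArtinSchreier {c ℓ} (Ω : StableField c ℓ) (s : Level) {p : ℕ} (prime : Prime p) where
  open StableField Ω hiding (zero)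
  open Mult semiring using () renaming (_×_ to _·_)
  open Exp semiring using (^-congʳ; ^-congˡ; ^-homo-*; ^-assocʳ)
  open CommutativeExp commutativeSemiring using (^-distrib-*)
  open Solver commutativeRing
  open LinearAlgebra Ω s
  open Adjunction Ω s
  open Radical Ω s
  open Frobenius commutativeRing prime
  open import Relation.Binary.Reasoning.Setoid setoid

  -- x is a root of Xᵖ - X - t.
  IsRoot : Carrier → Carrier → Set ℓ
  IsRoot t x = x ^ p ≈ x + t

  module _ (p·1≈0 : p · 1# ≈ 0#) {S : Subfield} where
    open Subfield S

    ring-frobenius : ∀ {r x} → S ∋[ r ] x → S ∋[ r ^ p ] (x ^ p)
    ring-frobenius {r} (n , x∈) = n , go n x∈
      where
      go : ∀ n {x} → Poly S r n x → Poly S (r ^ p) n (x ^ p)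
      go zero (nil x≈0) = nil (trans (^-congˡ p x≈0) (0^n≈0 (ℕ.<⇒≤ (prime>1 prime))))
      go (suc n) {x} (cons {a = a} {y = y} a∈ y∈ x≈) = cons (pow p a∈) (go n y∈) (begin
        x ^ p                      ≈⟨ ^-congˡ p x≈ ⟩
        (a * r ^ n + y) ^ p        ≈⟨ frobenius-+ p·1≈0 _ _ ⟩
        (a * r ^ n) ^ p + y ^ p    ≈⟨ +-congʳ (^-distrib-* a (r ^ n) p) ⟩
        a ^ p * (r ^ n) ^ p + y ^ p ≈⟨ +-congʳ (*-congˡ (trans (^-assocʳ r n p)
                                        (trans (^-congʳ r (ℕ.*-comm n p)) (sym (^-assocʳ r p n))))) ⟩
        a ^ p * (r ^ p) ^ n + y ^ p ∎)

    module _ {r m} (R : PureRelation {S} r m) (p∤m : ¬ (p ∣ m)) where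
      open PureRelation R
      open Minimal Ω s S r using (multiple-constant≈0)

      -- The p-th power of a combination of the rⁱ with 0 < i < d, where d is the degree, is again one:
      -- p does not divide d, so d does not divide i p.
      positive-frobenius : ∀ {e} → degree ≡ suc e → ∀ {n x} → n ℕ.≤ e → Span S (positive r n) x →
                           Span S (positive r e) (x ^ p)
      positive-frobenius _ {zero} _ (nil x≈0) =
        span-resp (sym (trans (^-congˡ p x≈0) (0^n≈0 (ℕ.<⇒≤ (prime>1 prime))))) span-0
      positive-frobenius {e} eq {suc n} {x} n<e (cons {a = a} {y = y} a∈ y∈ x≈) = span-resp
        (begin
          a ^ p * (r ^ suc n) ^ p + y ^ p ≈⟨ +-congʳ (sym (^-distrib-* a (r ^ suc n) p)) ⟩
          (a * r ^ suc n) ^ p + y ^ p     ≈⟨ sym (frobenius-+ p·1≈0 _ _) ⟩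
          (a * r ^ suc n + y) ^ p         ≈⟨ ^-congˡ p (sym x≈) ⟩
          x ^ p                           ∎)
        (span-+ (span-* (pow p a∈) (span-resp (sym split) (span-* (pow q (≡.subst (λ e → S ∋ r ^ e) eq r^degree∈))
            (positive∈ (ℕ.n≢0⇒n>0 k≢0) (ℕ.s≤s⁻¹ (m%n<n i (suc e)))))))
          (positive-frobenius eq (ℕ.<⇒≤ n<e) y∈))
        where
        i = suc n ℕ.* p
        q = i / suc e
        k = i % suc e
        k≢0 : ¬ (k ≡ 0)
        k≢0 k≡0 = ℕ.<⇒≱ n<e (ℕ.s≤s⁻¹ (∣⇒≤ (prime∤⇒∣ prime
          (λ p∣e → p∤m (∣-trans p∣e (≡.subst (_∣ m) eq degree∣m))) (m%n≡0⇒n∣m i (suc e) k≡0))))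
        split : (r ^ suc n) ^ p ≈ (r ^ suc e) ^ q * r ^ k
        split = begin
          (r ^ suc n) ^ p               ≈⟨ ^-assocʳ r (suc n) p ⟩
          r ^ i                         ≈⟨ ^-congʳ r (m≡m%n+[m/n]*n i (suc e)) ⟩
          r ^ (k ℕ.+ q ℕ.* suc e)       ≈⟨ ^-homo-* r k _ ⟩
          r ^ k * r ^ (q ℕ.* suc e)     ≈⟨ *-congˡ (trans (^-congʳ r (ℕ.*-comm q (suc e))) (sym (^-assocʳ r (suc e) q))) ⟩
          r ^ k * (r ^ suc e) ^ q       ≈⟨ *-comm _ _ ⟩
          (r ^ suc e) ^ q * r ^ k       ∎

      -- The constant term of a root is a root.
      root-descent : ∀ {e} → degree ≡ suc e → ∀ {t x} → S ∋ t → Poly S r (suc e) x → IsRoot t x →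
                     Σ[ a ∈ Carrier ] S ∋ a × IsRoot t a
      root-descent {e} eq {t} {x} t∈ x∈ root
        with a , y , a∈ , y∈ , x≈ ← constant-term e x∈
        with z , z∈ , rz≈ ← positive⇒multiple e (span-+ (positive-frobenius eq ℕ.≤-refl y∈) (span-neg y∈))
        = a , a∈ , (begin
          a ^ p                   ≈⟨ solve 3 (λ f a t → f := a :+ t :- (a :+ t :- f)) refl (a ^ p) a t ⟩
          a + t - (a + t - a ^ p) ≈⟨ +-congˡ (-‿cong (multiple-constant≈0 minimal (≡.sym eq) z∈
                                       (plus (plus a∈ t∈) (negate (pow p a∈))) (trans rz≈ difference))) ⟩
          a + t - 0#              ≈⟨ trans (+-congˡ (RingProperties.-0#≈0# ring)) (+-identityʳ _) ⟩
          a + t                   ∎)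
        where
        difference : y ^ p - y ≈ a + t - a ^ p
        difference = begin
          y ^ p - y                   ≈⟨ solve 3 (λ f a y → f :- y := a′ f a y) refl (y ^ p) (a ^ p) y ⟩
          (a ^ p + y ^ p) - a ^ p - y ≈⟨ +-congʳ (+-congʳ (trans (sym (frobenius-+ p·1≈0 a y))
                                          (trans (^-congˡ p (sym x≈)) (trans root (+-congʳ x≈))))) ⟩
          (a + y + t) - a ^ p - y     ≈⟨ solve 4 (λ f a y t → a :+ y :+ t :- f :- y := a :+ t :- f) refl (a ^ p) a y t ⟩
          a + t - a ^ p               ∎
          where
          a′ = λ f a y → (a :+ f) :- a :- y

    -- If S contains all roots of unity, a radical extension of S creates no root of Xᵖ - X - t.
    radical-step : RootsOfUnity S → ∀ {t} → S ∋ t → ∀ m → 0 ℕ.< m → ∀ {r} → S ∋ r ^ m →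
                   ∀ {x} → S ∋[ r ] x → IsRoot t x → ¬ ¬ (Σ[ a ∈ Carrier ] S ∋ a × IsRoot t a)
    radical-step μ⊆S {t} t∈ m = <-rec (λ m → 0 ℕ.< m → ∀ {r} → S ∋ r ^ m →
        ∀ {x} → S ∋[ r ] x → IsRoot t x → ¬ ¬ (Σ[ a ∈ Carrier ] S ∋ a × IsRoot t a)) go m
      where
      go : ∀ m → (∀ {k} → k ℕ.< m → 0 ℕ.< k → ∀ {r} → S ∋ r ^ k →
             ∀ {x} → S ∋[ r ] x → IsRoot t x → ¬ ¬ (Σ[ a ∈ Carrier ] S ∋ a × IsRoot t a)) →
           0 ℕ.< m → ∀ {r} → S ∋ r ^ m →
           ∀ {x} → S ∋[ r ] x → IsRoot t x → ¬ ¬ (Σ[ a ∈ Carrier ] S ∋ a × IsRoot t a)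
      go m rec 0<m {r} r^m∈ {x} x∈ root with p ∣? m
      ... | yes (divides (suc q) ≡.refl) =
        -- x = xᵖ - t lies in S[rᵖ]
        rec (ℕ.m<m*n (suc q) p (prime>1 prime)) ℕ.z<s
          (respects (trans (^-congʳ r (ℕ.*-comm (suc q) p)) (sym (^-assocʳ r p (suc q)))) r^m∈)
          (ring-resp (trans (+-congʳ root) (solve 2 (λ x t → x :+ t :- t := x) refl x t))
            (ring-+ (ring-frobenius x∈) (ring-neg (ring-const t∈)))) root
      ... | yes (divides zero ≡.refl) = contradiction 0<m (ℕ.<-irrefl ≡.refl)
      ... | no p∤m = ¬¬-excluded-middle >>= λ where
          (yes r≈0) → pure (x , ring-collapse (respects (sym r≈0) zero′) x∈ , root)
          (no r≉0)  → pureRelation μ⊆S r≉0 0<m r^m∈ >>= λ R → pure (conclude R (PureRelation.0<degree R) ≡.refl)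
        where
        conclude : (R : PureRelation r m) → ∀ {d} → 0 ℕ.< d → PureRelation.degree R ≡ d →
                   Σ[ a ∈ Carrier ] S ∋ a × IsRoot t a
        conclude R {suc e} 0<d eq = root-descent R p∤m eq t∈
          (Integral.reduce 0<d (radical-integral 0<d (≡.subst (λ e → S ∋ r ^ e) eq (PureRelation.r^degree∈ R))) x∈) root

-- Rational functions over fields generated by roots of unity

module Transcendence {c ℓ} (Ω : StableField c ℓ) (s : Level) where
  open StableField Ω hiding (zero)
  open Exp semiring using (^-congˡ; ^-homo-*)
  open CommutativeExp commutativeSemiring using (^-distrib-*)
  open RingProperties ring using (-0#≈0#)
  open Solver commutativeRing
  open LinearAlgebra Ω s
  open Adjunction Ω s
  open Radical Ω s
  open import Relation.Binary.Reasoning.Setoid setoid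

  -- No polynomial over S with nonzero leading coefficient vanishes at t.
  TranscendentalOver : Subfield → Carrier → Set (c ⊔ ℓ ⊔ s)
  TranscendentalOver S t = ∀ n {a y} → S ∋ a → Poly S t n y → a * t ^ n + y ≈ 0# → a ≈ 0#

  adjoin-⊆ : ∀ {S T r m} 0<m (i : Poly S r m (r ^ m)) (j : Poly T r m (r ^ m)) → S ⊆ T →
             Integral.adjoin 0<m i ⊆ Integral.adjoin 0<m j
  adjoin-⊆ _ _ _ S⊆T x∈ = x∈ >>= λ (n , x∈) → pure (n , span-mono S⊆T x∈)

  span-++ʳ : ∀ {S} vs {ws x} → Span S ws x → Span S (vs ++ ws) x
  span-++ʳ []       x∈ = x∈
  span-++ʳ (v ∷ vs) x∈ = span-weaken (span-++ʳ vs x∈)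

  span-++ˡ : ∀ {S vs ws x} → Span S vs x → Span S (vs ++ ws) x
  span-++ˡ (nil x≈0)        = span-resp (sym x≈0) span-0
  span-++ˡ (cons a∈ y∈ x≈) = cons a∈ (span-++ˡ y∈) x≈

  all-¬¬ : ∀ {P : Carrier → Set (c ⊔ ℓ ⊔ s)} {xs} → All (λ x → ¬ ¬ P x) xs → ¬ ¬ All P xs
  all-¬¬ []         = pure []
  all-¬¬ (px ∷ pxs) = px >>= λ px → all-¬¬ pxs >>= λ pxs → pure (px ∷ pxs)

  module _ {S : Subfield} {z m} (0<m : 0 ℕ.< m) (integral : Poly S z m (z ^ m)) where
    open Integral 0<m integral

    -- The products of the elements of a list with 1, …, zᵐ⁻¹.
    multiples : List Carrier → List Carrier
    multiples []       = []
    multiples (v ∷ vs) = map (v *_) (powers z m) ++ multiples vs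

    span-multiples : ∀ {vs x} → Span adjoin vs x → ¬ ¬ Span S (multiples vs) x
    span-multiples (nil x≈0) = pure (nil x≈0)
    span-multiples {v ∷ vs} (cons a∈ y∈ x≈) = a∈ >>= λ a∈ → span-multiples y∈ >>= λ y∈ →
      pure (span-resp (trans (+-congʳ (*-comm _ _)) (sym x≈)) (span-+
        (span-++ˡ (span-mul v (map⁻ (span-self (map (v *_) (powers z m)))) (reduce a∈)))
        (span-++ʳ (map (v *_) (powers z m)) y∈)))

    -- An algebraic relation of t over S(z) confines all powers of t to a space of finite
    -- dimension over S.
    transcendental-adjoin : ∀ {t} → TranscendentalOver S t → TranscendentalOver adjoin t
    transcendental-adjoin {t} trS n {a} {y} a∈ y∈ at^n+y≈0 = ≈-stable (¬¬-excluded-middle >>= λ where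
      (yes a≈0) → pure a≈0
      (no  a≉0) → inverse a a≉0 >>= λ (b , ab≈1) → contradiction
        (span-resp (begin
          b * - y                           ≈⟨ solve 4 (λ a b t y → b :* (:- y)
                                                 := (a :* b) :* t :- b :* (a :* t :+ y)) refl a b (t ^ n) y ⟩
          a * b * t ^ n - b * (a * t ^ n + y) ≈⟨ +-cong (trans (*-congʳ ab≈1) (*-identityˡ _))
                                                 (trans (-‿cong (trans (*-congˡ at^n+y≈0) (zeroʳ b))) -0#≈0#) ⟩
          t ^ n + 0#                        ≈⟨ +-identityʳ _ ⟩
          t ^ n                             ∎)
          (span-* (Subfield.recip adjoin a∈ ab≈1) (span-neg y∈)))
        (no-relation n))
      where
      independent-powers : ∀ k → ¬ Dependent S (powers t k)
      independent-powers (suc k) (here t^k∈) = 1≉0 (trS k (Subfield.one S) (span-neg t^k∈)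
        (trans (+-congʳ (*-identityˡ _)) (-‿inverseʳ _)))
      independent-powers (suc k) (there d)   = independent-powers k d

      no-relation : ∀ n → ¬ Poly adjoin t n (t ^ n)
      no-relation zero    (nil 1≈0) = 1≉0 1≈0
      no-relation (suc n) t^n∈ = all-¬¬ (powers-all t (suc N) (λ i _ →
            span-multiples (Integral.powers-integral ℕ.z<s t^n∈ i))) λ t^i∈ →
          steinitz vs (powers t (suc N))
            (≡.subst (N ℕ.<_) (≡.sym (length-powers t (suc N))) (ℕ.n<1+n N)) t^i∈
            (independent-powers (suc N))
        where
        vs = multiples (powers t (suc n))
        N = length vs

  -- A root of unity.
  record Unity : Set (c ⊔ ℓ) where
    field
      ζ      : Carrier
      order  : ℕ
      0<n    : 0 ℕ.< order
      ζ^n≈1  : ζ ^ order ≈ 1#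

  -- The subfield generated by a subfield F₀ and all roots of unity, as the directed union of the
  -- subfields generated by F₀ and finitely many roots of unity.
  module Cyclotomic (F₀ : Subfield) where

    -- The subfield generated by F₀ and the given roots of unity.
    finite : List Unity → Subfield
    unity-integral : ∀ (ζs : List Unity) u → let open Unity u in Poly (finite ζs) ζ order (ζ ^ order)
    finite []       = F₀
    finite (u ∷ ζs) = Integral.adjoin (Unity.0<n u) (unity-integral ζs u)
    unity-integral ζs u = radical-integral 0<n (Subfield.respects (finite ζs) (sym ζ^n≈1) (Subfield.one (finite ζs)))
      where open Unity u

    finite-⊆ʳ : ∀ ζs {ξs} → finite ξs ⊆ finite (ζs ++ ξs)
    finite-⊆ʳ []       x∈ = x∈
    finite-⊆ʳ (u ∷ ζs) x∈ = pure (ring-const (finite-⊆ʳ ζs x∈))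

    finite-⊆ˡ : ∀ ζs {ξs} → finite ζs ⊆ finite (ζs ++ ξs)
    finite-⊆ˡ []       {ξs} x∈ = F₀⊆finite ξs x∈
      where
      F₀⊆finite : ∀ ζs → F₀ ⊆ finite ζs
      F₀⊆finite []       x∈ = x∈
      F₀⊆finite (u ∷ ζs) x∈ = pure (ring-const (F₀⊆finite ζs x∈))
    finite-⊆ˡ (u ∷ ζs) {ξs} = adjoin-⊆ (Unity.0<n u) (unity-integral ζs u) (unity-integral (ζs ++ ξs) u) (finite-⊆ˡ ζs)

    cyclotomic : Subfield
    cyclotomic = record
      { member   = λ x → ¬ ¬ (∃[ ζs ] finite ζs ∋ x)
      ; respects = λ x≈y x∈ → x∈ >>= λ (ζs , x∈) → pure (ζs , Subfield.respects (finite ζs) x≈y x∈)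
      ; stable   = λ x∈ → x∈ >>= id
      ; one      = pure ([] , Subfield.one F₀)
      ; plus     = λ x∈ y∈ → x∈ >>= λ (ζs , x∈) → y∈ >>= λ (ξs , y∈) →
          pure (ζs ++ ξs , Subfield.plus (finite (ζs ++ ξs)) (finite-⊆ˡ ζs x∈) (finite-⊆ʳ ζs y∈))
      ; times    = λ x∈ y∈ → x∈ >>= λ (ζs , x∈) → y∈ >>= λ (ξs , y∈) →
          pure (ζs ++ ξs , Subfield.times (finite (ζs ++ ξs)) (finite-⊆ˡ ζs x∈) (finite-⊆ʳ ζs y∈))
      ; negate   = λ x∈ → x∈ >>= λ (ζs , x∈) → pure (ζs , Subfield.negate (finite ζs) x∈)
      ; recip    = λ x∈ xy≈1 → x∈ >>= λ (ζs , x∈) → pure (ζs , Subfield.recip (finite ζs) x∈ xy≈1)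
      }

    cyclotomic-unity : RootsOfUnity cyclotomic
    cyclotomic-unity z n 0<n z^n≈1 = pure
      (record { ζ = z ; order = n ; 0<n = 0<n ; ζ^n≈1 = z^n≈1 } ∷ [] , pure (2 , poly-var))

    finite-transcendental : ∀ {t} → TranscendentalOver F₀ t → ∀ ζs → TranscendentalOver (finite ζs) t
    finite-transcendental tr []       = tr
    finite-transcendental tr (u ∷ ζs) =
      transcendental-adjoin (Unity.0<n u) (unity-integral ζs u) (finite-transcendental tr ζs)

    span-finite : ∀ {vs x} → Span cyclotomic vs x → ¬ ¬ (∃[ ζs ] Span (finite ζs) vs x)
    span-finite (nil x≈0) = pure ([] , nil x≈0)
    span-finite (cons a∈ y∈ x≈) = a∈ >>= λ (ζs , a∈) → span-finite y∈ >>= λ (ξs , y∈) →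
      pure (ζs ++ ξs , cons (finite-⊆ˡ ζs a∈) (span-mono (λ {x} → finite-⊆ʳ ζs {ξs} {x}) y∈) x≈)

    cyclotomic-transcendental : ∀ {t} → TranscendentalOver F₀ t → TranscendentalOver cyclotomic t
    cyclotomic-transcendental tr n a∈ y∈ eq = ≈-stable
      (a∈ >>= λ (ζs , a∈) → span-finite y∈ >>= λ (ξs , y∈) → pure
        (finite-transcendental tr (ζs ++ ξs) n (finite-⊆ˡ ζs a∈)
          (span-mono (λ {x} → finite-⊆ʳ ζs {ξs} {x}) y∈) eq))

  -- x = f / g with f and g in S[t].
  Quotient : Subfield → Carrier → Carrier → Set (c ⊔ ℓ ⊔ s)
  Quotient S t x = Σ[ f ∈ Carrier ] Σ[ g ∈ Carrier ] S ∋[ t ] f × S ∋[ t ] g × ¬ (g ≈ 0#) × x * g ≈ f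

  -- The field S(t).
  fractions : Subfield → Carrier → Subfield
  fractions S t = record
    { member   = λ x → ¬ ¬ Quotient S t x
    ; respects = λ x≈y x∈ → x∈ >>= λ (f , g , f∈ , g∈ , g≉0 , xg≈f) →
        pure (f , g , f∈ , g∈ , g≉0 , trans (*-congʳ (sym x≈y)) xg≈f)
    ; stable   = λ x∈ → x∈ >>= id
    ; one      = pure (1# , 1# , ring-const one , ring-const one , 1≉0 , *-identityˡ 1#)
    ; plus     = λ {x} {y} x∈ y∈ → x∈ >>= λ (f , g , f∈ , g∈ , g≉0 , xg≈f) →
        y∈ >>= λ (h , k , h∈ , k∈ , k≉0 , yk≈h) →
        pure (f * k + h * g , g * k , ring-+ (ring-* f∈ k∈) (ring-* h∈ g∈) , ring-* g∈ k∈ , nonzero-* g≉0 k≉0 ,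
          trans (solve 4 (λ x y g k → (x :+ y) :* (g :* k) := x :* g :* k :+ y :* k :* g) refl x y g k)
            (+-cong (*-congʳ xg≈f) (*-congʳ yk≈h)))
    ; times    = λ {x} {y} x∈ y∈ → x∈ >>= λ (f , g , f∈ , g∈ , g≉0 , xg≈f) →
        y∈ >>= λ (h , k , h∈ , k∈ , k≉0 , yk≈h) →
        pure (f * h , g * k , ring-* f∈ h∈ , ring-* g∈ k∈ , nonzero-* g≉0 k≉0 ,
          trans (solve 4 (λ x y g k → x :* y :* (g :* k) := x :* g :* (y :* k)) refl x y g k)
            (*-cong xg≈f yk≈h))
    ; negate   = λ {x} x∈ → x∈ >>= λ (f , g , f∈ , g∈ , g≉0 , xg≈f) →
        pure (- f , g , ring-neg f∈ , g∈ , g≉0 ,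
          trans (solve 2 (λ x g → (:- x) :* g := :- (x :* g)) refl x g) (-‿cong xg≈f))
    ; recip    = λ {x} {y} x∈ xy≈1 → x∈ >>= λ (f , g , f∈ , g∈ , g≉0 , xg≈f) → let
          yf≈g = begin
            y * f         ≈⟨ *-congˡ (sym xg≈f) ⟩
            y * (x * g)   ≈⟨ solve 3 (λ x y g → y :* (x :* g) := x :* y :* g) refl x y g ⟩
            x * y * g     ≈⟨ trans (*-congʳ xy≈1) (*-identityˡ g) ⟩
            g             ∎
        in pure (g , f , g∈ , f∈ , (λ f≈0 → g≉0 (trans (sym yf≈g) (trans (*-congˡ f≈0) (zeroʳ y)))) , yf≈g)
    }
    where open Subfield S

  fractions-const : ∀ {S t} → S ⊆ fractions S t
  fractions-const {S} x∈ = pure (_ , 1# , ring-const x∈ , ring-const (Subfield.one S) , 1≉0 , *-identityʳ _)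

  fractions-var : ∀ {S t} → fractions S t ∋ t
  fractions-var {S} = pure (_ , 1# , (2 , poly-var) , ring-const (Subfield.one S) , 1≉0 , *-identityʳ _)

  module Degree {S : Subfield} {t : Carrier} (tr : TranscendentalOver S t) where
    open Subfield S

    leading-bound : ∀ {n x} → Leading {S} {t} n x → Poly S t (suc n) x
    leading-bound (a , y , a∈ , _ , y∈ , x≈) = cons a∈ y∈ x≈

    leading-unbounded : ∀ {n x} → Leading {S} {t} n x → ¬ Poly S t n x
    leading-unbounded {n} {x} (a , y , a∈ , a≉0 , y∈ , x≈) x∈ = a≉0 (tr n a∈ (span-+ y∈ (span-neg x∈)) (begin
      a * t ^ n + (y - x)   ≈⟨ sym (+-assoc _ _ _) ⟩
      a * t ^ n + y - x     ≈⟨ +-congʳ (sym x≈) ⟩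
      x - x                 ≈⟨ -‿inverseʳ x ⟩
      0#                    ∎))

    shift : ∀ m {n x} → Poly S t n x → Poly S t (m ℕ.+ n) (t ^ m * x)
    shift m {n} = span-mul (t ^ m) (powers-all t n λ i i<n →
      span-resp (^-homo-* t m i) (power∈ (ℕ.+-monoʳ-< m i<n)))

    leading-* : ∀ {m n x y} → Leading {S} {t} m x → Leading {S} {t} n y → Leading {S} {t} (m ℕ.+ n) (x * y)
    leading-* {m} {n} {x} {y} (a , u , a∈ , a≉0 , u∈ , x≈) (b , v , b∈ , b≉0 , v∈ , y≈) =
      a * b , a * (t ^ m * v) + b * (t ^ n * u) + u * v , times a∈ b∈ , nonzero-* a≉0 b≉0 ,
      span-+ (span-+ (span-* a∈ (shift m v∈))
        (span-* b∈ (≡.subst (λ k → Poly S t k (t ^ n * u)) (ℕ.+-comm n m) (shift n u∈)))) (poly-* u∈ v∈) ,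
      (begin
        x * y                             ≈⟨ *-cong x≈ y≈ ⟩
        (a * t ^ m + u) * (b * t ^ n + v) ≈⟨ solve 6 (λ a b p q u v → (a :* p :+ u) :* (b :* q :+ v)
            := a :* b :* (p :* q) :+ (a :* (p :* v) :+ b :* (q :* u) :+ u :* v)) refl a b (t ^ m) (t ^ n) u v ⟩
        a * b * (t ^ m * t ^ n) + w       ≈⟨ +-congʳ (*-congˡ (sym (^-homo-* t m n))) ⟩
        a * b * t ^ (m ℕ.+ n) + w         ∎)
      where w = a * (t ^ m * v) + b * (t ^ n * u) + u * v

    leading-^ : ∀ {n x} k → Leading {S} {t} n x → Leading {S} {t} (k ℕ.* n) (x ^ k)
    leading-^ zero    l = 1# , 0# , one , 1≉0 , nil refl , sym (trans (+-identityʳ _) (*-identityˡ _))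
    leading-^ (suc k) l = leading-* l (leading-^ k l)

    leading-var : Leading {S} {t} 1 t
    leading-var = 1# , 0# , one , 1≉0 , span-0 ,
      sym (trans (+-identityʳ _) (trans (*-identityˡ _) (*-identityʳ t)))

    bounded-* : ∀ {m n x y} → Poly S t (suc m) x → Poly S t (suc n) y → Poly S t (suc (m ℕ.+ n)) (x * y)
    bounded-* {m} {n} = span-product (powers-all t (suc m) λ i i≤m → powers-all t (suc n) λ j j≤n →
      span-resp (^-homo-* t i j) (power∈ (ℕ.s≤s (ℕ.+-mono-≤ (ℕ.s≤s⁻¹ i≤m) (ℕ.s≤s⁻¹ j≤n)))))

    bounded-^ : ∀ {n x} k → Poly S t (suc n) x → Poly S t (suc (k ℕ.* n)) (x ^ k)
    bounded-^ zero    x∈ = poly-const {r = t} one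
    bounded-^ (suc k) x∈ = bounded-* x∈ (bounded-^ k x∈)

    -- Writing a root as f / g gives fᵖ - f gᵖ⁻¹ = t gᵖ, in which the degrees do not match.
    no-root : ∀ p → 1 ℕ.< p → ∀ {x} → fractions S t ∋ x → ¬ (x ^ p ≈ x + t)
    no-root (suc q) 1<p {x} x∈ root = x∈ λ (f , g , (m , f∈) , (n , g∈) , g≉0 , xg≈f) →
      leading n g∈ λ where
        (inj₁ g≈0) → g≉0 g≈0
        (inj₂ (k , _ , lg)) → let
            equation : f ^ suc q ≈ f * g ^ q + t * g ^ suc q
            equation = begin
              f ^ suc q                       ≈⟨ ^-congˡ (suc q) (sym xg≈f) ⟩
              (x * g) ^ suc q                 ≈⟨ ^-distrib-* x g (suc q) ⟩
              x ^ suc q * g ^ suc q           ≈⟨ *-congʳ root ⟩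
              (x + t) * (g * g ^ q)           ≈⟨ solve 4 (λ x t g h → (x :+ t) :* (g :* h)
                                                   := x :* g :* h :+ t :* (g :* h)) refl x t g (g ^ q) ⟩
              x * g * g ^ q + t * g ^ suc q   ≈⟨ +-congʳ (*-congʳ xg≈f) ⟩
              f * g ^ q + t * g ^ suc q       ∎
            equation′ : f ^ suc q - f * g ^ q ≈ t * g ^ suc q
            equation′ = trans (+-congʳ equation)
              (solve 2 (λ u v → u :+ v :- u := v) refl (f * g ^ q) (t * g ^ suc q))
            rhs : Leading {S} {t} (suc (suc q ℕ.* k)) (t * g ^ suc q)
            rhs = leading-* leading-var (leading-^ (suc q) lg)
            -- If deg f ≤ deg g, the left-hand side has degree at most p deg g.
            low : Poly S t (suc k) f → ⊥
            low f∈ = leading-unbounded rhs (span-resp equation′ (span-+ (bounded-^ (suc q) f∈)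
              (span-neg (bounded-* f∈ (bounded-^ q (leading-bound lg))))))
          in leading m f∈ λ where
            (inj₁ f≈0) → low (span-resp (sym f≈0) span-0)
            (inj₂ (n , _ , lf)) → compare lf lg low equation rhs (ℕ.≤-<-connex n k)
      where
      -- If deg f > deg g, the term fᵖ has the highest degree.
      compare : ∀ {f g n k} → Leading {S} {t} n f → Leading {S} {t} k g → (Poly S t (suc k) f → ⊥) →
                f ^ suc q ≈ f * g ^ q + t * g ^ suc q → Leading {S} {t} (suc (suc q ℕ.* k)) (t * g ^ suc q) →
                n ℕ.≤ k ⊎ k ℕ.< n → ⊥
      compare lf lg low equation rhs (inj₁ n≤k) = low (poly-mono (ℕ.s≤s n≤k) (leading-bound lf))
      compare {n = n} {k} lf lg low equation rhs (inj₂ k<n) = leading-unbounded (leading-^ (suc q) lf)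
        (span-resp (sym equation) (span-+
          (poly-mono (ℕ.+-monoʳ-< n (ℕ.*-monoʳ-< q ⦃ ℕ.>-nonZero (ℕ.s<s⁻¹ 1<p) ⦄ k<n))
            (leading-bound (leading-* lf (leading-^ q lg))))
          (poly-mono bound (leading-bound rhs))))
        where
        bound : suc (suc (suc q ℕ.* k)) ℕ.≤ suc q ℕ.* n
        bound = ℕ.≤-trans (ℕ.+-monoˡ-≤ (suc q ℕ.* k) 1<p)
          (≡.subst (ℕ._≤ suc q ℕ.* n) (ℕ.*-suc (suc q) k) (ℕ.*-monoʳ-≤ (suc q) k<n))

-- Adjoining a root of X² - r X + 1

-- u is a root of X² - r X + 1, that is r = u + 1 / u.
UnitSum : ∀ {c ℓ} (Ω : StableField c ℓ) (r u : StableField.Carrier Ω) → Set ℓ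
UnitSum Ω r u = u * u + 1# ≈ r * u
  where open StableField Ω

-- An extension Ω′ of Ω containing a root of X² - r X + 1.
record RootExtension {c ℓ} (Ω : StableField c ℓ) (r : StableField.Carrier Ω) : Set (lsuc (c ⊔ ℓ)) where
  field
    Ω′     : StableField c ℓ
    φ      : StableField.Carrier Ω → StableField.Carrier Ω′
    φ-hom  : IsRingHomomorphism (StableField.rawRing Ω) (StableField.rawRing Ω′) φ
    u      : StableField.Carrier Ω′
    u-root : UnitSum Ω′ (φ r) u

module Quadratic {c ℓ} (Ω : StableField c ℓ) (r : StableField.Carrier Ω)
                 (irreducible : ∀ u → ¬ UnitSum Ω r u) where
  open StableField Ω
  open RingProperties ring using (-0#≈0#)
  open Solver commutativeRing
  open LinearAlgebra Ω c using (nonzero-*)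
  open import Relation.Binary.Reasoning.Setoid setoid

  -- The pair (x , y) stands for x + y u, where u² = r u - 1.
  private
    Pair : Set c
    Pair = Carrier × Carrier

    _≈′_ : Pair → Pair → Set ℓ
    (x , y) ≈′ (z , w) = x ≈ z × y ≈ w

    _+′_ _*′_ : Pair → Pair → Pair
    (x , y) +′ (z , w) = x + z , y + w
    (x , y) *′ (z , w) = x * z - y * w , x * w + y * z + r * (y * w)

  pairs : CommutativeRing c ℓ
  pairs = record
    { Carrier = Pair
    ; _≈_ = _≈′_
    ; _+_ = _+′_
    ; _*_ = _*′_
    ; -_  = λ (x , y) → - x , - y
    ; 0#  = 0# , 0#
    ; 1#  = 1# , 0#
    ; isCommutativeRing = record
      { isRing = record
        { +-isAbelianGroup = record
          { isGroup = record
            { isMonoid = record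
              { isSemigroup = record
                { isMagma = record
                  { isEquivalence = record
                    { refl  = refl , refl
                    ; sym   = λ (p , q) → sym p , sym q
                    ; trans = λ (p , q) (p′ , q′) → trans p p′ , trans q q′
                    }
                  ; ∙-cong = λ (p , q) (p′ , q′) → +-cong p p′ , +-cong q q′
                  }
                ; assoc = λ _ _ _ → +-assoc _ _ _ , +-assoc _ _ _
                }
              ; identity = (λ _ → +-identityˡ _ , +-identityˡ _) , (λ _ → +-identityʳ _ , +-identityʳ _)
              }
            ; inverse = (λ _ → -‿inverseˡ _ , -‿inverseˡ _) , (λ _ → -‿inverseʳ _ , -‿inverseʳ _)
            ; ⁻¹-cong = λ (p , q) → -‿cong p , -‿cong q
            }
          ; comm = λ _ _ → +-comm _ _ , +-comm _ _
          }
        ; *-cong = λ (p , q) (p′ , q′) → +-cong (*-cong p p′) (-‿cong (*-cong q q′)) ,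
            +-cong (+-cong (*-cong p q′) (*-cong q p′)) (*-congˡ (*-cong q q′))
        ; *-assoc = λ (a , b) (c , d) (e , f) →
            solve 7 (λ r a b c d e f → (a :* c :- b :* d) :* e :- (a :* d :+ b :* c :+ r :* (b :* d)) :* f
              := a :* (c :* e :- d :* f) :- b :* (c :* f :+ d :* e :+ r :* (d :* f))) refl r a b c d e f ,
            solve 7 (λ r a b c d e f → (a :* c :- b :* d) :* f :+ (a :* d :+ b :* c :+ r :* (b :* d)) :* e
                :+ r :* ((a :* d :+ b :* c :+ r :* (b :* d)) :* f)
              := a :* (c :* f :+ d :* e :+ r :* (d :* f)) :+ b :* (c :* e :- d :* f)
                :+ r :* (b :* (c :* f :+ d :* e :+ r :* (d :* f)))) refl r a b c d e f
        ; *-identity = (λ x → trans (proj₁ (*′-comm (1# , 0#) x)) (proj₁ (identityʳ x)) ,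
                              trans (proj₂ (*′-comm (1# , 0#) x)) (proj₂ (identityʳ x))) , identityʳ
        ; distrib = distribˡ′ , λ x y z →
            trans (proj₁ (*′-comm (y +′ z) x)) (trans (proj₁ (distribˡ′ x y z))
              (+-cong (proj₁ (*′-comm x y)) (proj₁ (*′-comm x z)))) ,
            trans (proj₂ (*′-comm (y +′ z) x)) (trans (proj₂ (distribˡ′ x y z))
              (+-cong (proj₂ (*′-comm x y)) (proj₂ (*′-comm x z))))
        }
      ; *-comm = *′-comm
      }
    }
    where
    *′-comm : ∀ x y → (x *′ y) ≈′ (y *′ x)
    *′-comm (a , b) (c , d) = solve 4 (λ a b c d → a :* c :- b :* d := c :* a :- d :* b) refl a b c d ,
      solve 5 (λ r a b c d → a :* d :+ b :* c :+ r :* (b :* d) := c :* b :+ d :* a :+ r :* (d :* b)) refl r a b c d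
    identityʳ : ∀ x → (x *′ (1# , 0#)) ≈′ x
    identityʳ (a , b) = trans (+-cong (*-identityʳ a) (trans (-‿cong (zeroʳ b)) -0#≈0#)) (+-identityʳ a) ,
      trans (+-cong (+-cong (zeroʳ a) (*-identityʳ b)) (trans (*-congˡ (zeroʳ b)) (zeroʳ r)))
        (trans (+-identityʳ _) (+-identityˡ b))
    distribˡ′ : ∀ x y z → (x *′ (y +′ z)) ≈′ ((x *′ y) +′ (x *′ z))
    distribˡ′ (a , b) (c , d) (e , f) =
      solve 6 (λ a b c d e f → a :* (c :+ e) :- b :* (d :+ f) := (a :* c :- b :* d) :+ (a :* e :- b :* f))
        refl a b c d e f ,
      solve 7 (λ r a b c d e f → a :* (d :+ f) :+ b :* (c :+ e) :+ r :* (b :* (d :+ f))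
          := (a :* d :+ b :* c :+ r :* (b :* d)) :+ (a :* f :+ b :* e :+ r :* (b :* f)))
        refl r a b c d e f

  -- The norm of x + y u; it vanishes only at zero, as otherwise - x / y would be a root.
  norm≉0 : ∀ x y → ¬ (x ≈ 0# × y ≈ 0#) → ¬ (x * x + r * (x * y) + y * y ≈ 0#)
  norm≉0 x y xy≉0 N≈0 = ¬¬-excluded-middle λ where
    (yes y≈0) → xy≉0 (≈-stable (λ x≉0 → nonzero-* x≉0 x≉0 (begin
      x * x                         ≈⟨ sym (trans (+-cong (+-congˡ (trans (*-congˡ (trans (*-congˡ y≈0) (zeroʳ x))) (zeroʳ r)))
                                         (trans (*-congˡ y≈0) (zeroʳ y))) (trans (+-identityʳ _) (+-identityʳ _))) ⟩
      x * x + r * (x * y) + y * y   ≈⟨ N≈0 ⟩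
      0#                            ∎)) , y≈0)
    (no y≉0) → inverse y y≉0 λ (z , yz≈1) → irreducible (- (x * z)) (begin
      - (x * z) * - (x * z) + 1#    ≈⟨ +-congˡ (sym (trans (*-cong yz≈1 yz≈1) (*-identityˡ 1#))) ⟩
      - (x * z) * - (x * z) + (y * z) * (y * z)
        ≈⟨ solve 4 (λ r x y z → (:- (x :* z)) :* (:- (x :* z)) :+ (y :* z) :* (y :* z)
             := z :* z :* (x :* x :+ r :* (x :* y) :+ y :* y) :- r :* (x :* z) :* (y :* z)) refl r x y z ⟩
      z * z * (x * x + r * (x * y) + y * y) - r * (x * z) * (y * z)
        ≈⟨ +-cong (trans (*-congˡ N≈0) (zeroʳ _)) (-‿cong (trans (*-congˡ yz≈1) (*-identityʳ _))) ⟩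
      0# - r * (x * z)              ≈⟨ +-identityˡ _ ⟩
      - (r * (x * z))               ≈⟨ solve 3 (λ r x z → :- (r :* (x :* z)) := r :* (:- (x :* z))) refl r x z ⟩
      r * - (x * z)                 ∎)

  extension : RootExtension Ω r
  extension = record
    { Ω′ = record
      { commutativeRing = pairs
      ; ≈-stable = λ ¬¬eq → ≈-stable (¬¬eq >>= λ (p , _) → pure p) , ≈-stable (¬¬eq >>= λ (_ , q) → pure q)
      ; 1≉0      = λ (1≈0 , _) → 1≉0 1≈0
      -- the conjugate (x + r y) - y u divided by the norm
      ; inverse  = λ (x , y) xy≉0 → inverse _ (norm≉0 x y xy≉0) >>= λ (n , Nn≈1) → pure
          (((x + r * y) * n , - y * n) ,
           trans (solve 4 (λ r x y n → x :* ((x :+ r :* y) :* n) :- y :* ((:- y) :* n)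
             := (x :* x :+ r :* (x :* y) :+ y :* y) :* n) refl r x y n) Nn≈1 ,
           trans (solve 4 (λ r x y n → x :* ((:- y) :* n) :+ y :* ((x :+ r :* y) :* n) :+ r :* (y :* ((:- y) :* n))
             := n :- n) refl r x y n) (-‿inverseʳ n))
      }
    ; φ      = λ x → x , 0#
    ; φ-hom  = record
      { isSemiringHomomorphism = record
        { isNearSemiringHomomorphism = record
          { +-isMonoidHomomorphism = record
            { isMagmaHomomorphism = record
              { isRelHomomorphism = record { cong = λ x≈y → x≈y , refl }
              ; homo = λ _ _ → refl , sym (+-identityˡ 0#)
              }
            ; ε-homo = refl , refl
            }
          ; *-homo = λ x y →
              sym (trans (+-congˡ (trans (-‿cong (zeroˡ 0#)) -0#≈0#)) (+-identityʳ _)) ,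
              sym (trans (+-cong (trans (+-cong (zeroʳ x) (zeroˡ y)) (+-identityˡ 0#))
                (trans (*-congˡ (zeroˡ 0#)) (zeroʳ r))) (+-identityˡ 0#))
          }
        ; 1#-homo = refl , refl
        }
      ; -‿homo = λ _ → refl , sym -0#≈0#
      }
    ; u      = 0# , 1#
    ; u-root =
        (begin
          0# * 0# - 1# * 1# + 1#          ≈⟨ +-congʳ (+-cong (zeroˡ 0#) (-‿cong (*-identityˡ 1#))) ⟩
          0# - 1# + 1#                    ≈⟨ solve 2 (λ z i → z :- i :+ i := z) refl 0# 1# ⟩
          0#                              ≈⟨ sym (-‿inverseʳ 0#) ⟩
          0# - 0#                         ≈⟨ sym (+-cong (zeroʳ r) (-‿cong (zeroˡ 1#))) ⟩
          r * 0# - 0# * 1#                ∎) ,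
        trans (solve 3 (λ r z i → z :* i :+ i :* z :+ r :* (i :* i) :+ z := r :* (i :* i) :+ z :+ z :* i :+ i :* z)
          refl r 0# 1#) (begin
          r * (1# * 1#) + 0# + 0# * 1# + 1# * 0#  ≈⟨ +-cong (+-cong (+-cong (*-congˡ (*-identityˡ 1#)) (sym (zeroˡ 0#)))
                                                       (trans (zeroˡ 1#) (sym (trans (*-congˡ (zeroˡ 1#)) (zeroʳ r))))) (zeroʳ 1#) ⟩
          r * 1# + 0# * 0# + r * (0# * 1#) + 0#   ≈⟨ +-identityʳ _ ⟩
          r * 1# + 0# * 0# + r * (0# * 1#)        ∎)
    }

-- Either Ω itself contains a root, or the polynomial is irreducible.
rootExtension : ∀ {c ℓ} (Ω : StableField c ℓ) r → ¬ ¬ RootExtension Ω r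
rootExtension Ω r = ¬¬-excluded-middle {A = ∃[ u ] UnitSum Ω r u} >>= λ where
    (yes (u , root)) → pure (record
      { Ω′     = Ω
      ; φ      = id
      ; φ-hom  = isRingHomomorphism (StableField.rawRing Ω) (StableField.refl Ω)
      ; u      = u
      ; u-root = root
      })
    (no none)        → pure (Quadratic.extension Ω r (λ x root → none (x , root)))

-- Evaluation of polynomials, and homomorphisms

module Evaluation {a b ℓ₁ ℓ₂} (A : CommutativeRing a ℓ₁) (B : CommutativeRing b ℓ₂) where
  private
    module A = CommutativeRing A
    module B = CommutativeRing B
  open CommutativeRing B hiding (rawRing)
  open Polynomials A.rawRing
  private module B[X] = Polynomials B.rawRing
  open RingProperties ring using (-0#≈0#)
  open Solver B
  open import Relation.Binary.Reasoning.Setoid setoid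

  eval-cong : ∀ f g → f B[X].≈ᴾ g → ∀ x → B[X].eval f x ≈ B[X].eval g x
  eval-cong []      []      f≈g x = refl
  eval-cong []      (b ∷ g) f≈g x = sym (trans (+-cong (sym (f≈g 0))
    (trans (*-congˡ (sym (eval-cong [] g (f≈g ∘ suc) x))) (zeroʳ x))) (+-identityʳ 0#))
  eval-cong (a ∷ f) []      f≈g x = trans (+-cong (f≈g 0)
    (trans (*-congˡ (eval-cong f [] (f≈g ∘ suc) x)) (zeroʳ x))) (+-identityʳ 0#)
  eval-cong (a ∷ f) (b ∷ g) f≈g x = +-cong (f≈g 0) (*-congˡ (eval-cong f g (f≈g ∘ suc) x))

  module _ {φ : A.Carrier → Carrier} (hom : IsRingHomomorphism A.rawRing B.rawRing φ) (x : Carrier) where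
    open IsRingHomomorphism hom

    -- The value at x of a polynomial over A, with coefficients mapped to B.
    evalAt : Poly → Carrier
    evalAt f = B[X].eval (map φ f) x

    eval-+ : ∀ f g → evalAt (f +ᴾ g) ≈ evalAt f + evalAt g
    eval-+ []      g       = sym (+-identityˡ _)
    eval-+ (a ∷ f) []      = sym (+-identityʳ _)
    eval-+ (a ∷ f) (b ∷ g) = trans (+-cong (+-homo a b) (*-congˡ (eval-+ f g)))
      (solve 5 (λ a b x f g → (a :+ b) :+ x :* (f :+ g) := (a :+ x :* f) :+ (b :+ x :* g)) refl (φ a) (φ b) x _ _)

    eval-neg : ∀ f → evalAt (-ᴾ f) ≈ - evalAt f
    eval-neg []      = sym -0#≈0#
    eval-neg (a ∷ f) = trans (+-cong (-‿homo a) (*-congˡ (eval-neg f)))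
      (solve 3 (λ a x f → (:- a) :+ x :* (:- f) := :- (a :+ x :* f)) refl (φ a) x _)

    eval-scale : ∀ a f → evalAt (map (a A.*_) f) ≈ φ a * evalAt f
    eval-scale a []      = sym (zeroʳ _)
    eval-scale a (b ∷ f) = trans (+-cong (*-homo a b) (*-congˡ (eval-scale a f)))
      (solve 4 (λ a b x f → a :* b :+ x :* (a :* f) := a :* (b :+ x :* f)) refl (φ a) (φ b) x _)

    eval-* : ∀ f g → evalAt (f *ᴾ g) ≈ evalAt f * evalAt g
    eval-* []      g = sym (zeroˡ _)
    eval-* (a ∷ f) g = begin
      evalAt (map (a A.*_) g +ᴾ (A.0# ∷ (f *ᴾ g)))          ≈⟨ eval-+ (map (a A.*_) g) _ ⟩
      evalAt (map (a A.*_) g) + (φ A.0# + x * evalAt (f *ᴾ g)) ≈⟨ +-cong (eval-scale a g)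
         (trans (+-congʳ 0#-homo) (trans (+-identityˡ _) (*-congˡ (eval-* f g)))) ⟩
      φ a * evalAt g + x * (evalAt f * evalAt g)            ≈⟨ solve 4 (λ a x f g → a :* g :+ x :* (f :* g)
                                                                 := (a :+ x :* f) :* g) refl (φ a) x _ _ ⟩
      (φ a + x * evalAt f) * evalAt g                       ∎

    eval-C : ∀ a → evalAt (C a) ≈ φ a
    eval-C a = trans (+-congˡ (zeroʳ x)) (+-identityʳ _)

    eval-X : evalAt X ≈ x
    eval-X = trans (+-cong 0#-homo (trans (*-congˡ (trans (eval-C A.1#) 1#-homo)) (*-identityʳ x))) (+-identityˡ x)

    eval-X^ : ∀ n → evalAt (X ^ᴾ n) ≈ power B.rawRing x n
    eval-X^ zero    = trans (eval-C A.1#) 1#-homo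
    eval-X^ (suc n) = trans (eval-* X (X ^ᴾ n)) (*-cong eval-X (eval-X^ n))

    eval-artinSchreier : ∀ p t → evalAt (X ^ᴾ p -ᴾ X -ᴾ C t) ≈ power B.rawRing x p - x - φ t
    eval-artinSchreier p t = trans (eval-+ (X ^ᴾ p -ᴾ X) (-ᴾ C t)) (+-cong
      (trans (eval-+ (X ^ᴾ p) (-ᴾ X)) (+-cong (eval-X^ p) (trans (eval-neg X) (-‿cong eval-X))))
      (trans (eval-neg (C t)) (-‿cong (eval-C t))))

power-hom : ∀ {a b ℓ₁ ℓ₂} (A : CommutativeRing a ℓ₁) (B : CommutativeRing b ℓ₂) →
  let module A = CommutativeRing A
      module B = CommutativeRing B
  in
  ∀ {φ} → IsRingHomomorphism A.rawRing B.rawRing φ → ∀ x n → φ (power A.rawRing x n) B.≈ power B.rawRing (φ x) n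
power-hom A B hom x zero    = IsRingHomomorphism.1#-homo hom
power-hom A B hom x (suc n) = trans (IsRingHomomorphism.*-homo hom x _) (*-congˡ (power-hom A B hom x n))
  where open CommutativeRing B

multiple-hom : ∀ {a b ℓ₁ ℓ₂} (A : CommutativeRing a ℓ₁) (B : CommutativeRing b ℓ₂) →
  let module A = CommutativeRing A
      module B = CommutativeRing B
  in
  ∀ {φ} → IsRingHomomorphism A.rawRing B.rawRing φ →
  ∀ n → φ (Mult._×_ A.semiring n A.1#) B.≈ Mult._×_ B.semiring n B.1#
multiple-hom A B hom zero    = IsRingHomomorphism.0#-homo hom
multiple-hom A B hom (suc n) = trans (IsRingHomomorphism.+-homo hom _ _)
  (+-cong (IsRingHomomorphism.1#-homo hom) (multiple-hom A B hom n))
  where open CommutativeRing B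

chebyshev-hom : ∀ {a b ℓ₁ ℓ₂} (A : CommutativeRing a ℓ₁) (B : CommutativeRing b ℓ₂) →
  let module A = CommutativeRing A
      module B = CommutativeRing B
  in
  ∀ {φ} → IsRingHomomorphism A.rawRing B.rawRing φ →
  ∀ x n → φ (chebyshevPower A.rawRing x n) B.≈ chebyshevPower B.rawRing (φ x) n
chebyshev-hom A B hom x zero          =
  trans (IsRingHomomorphism.+-homo hom _ _) (+-cong (IsRingHomomorphism.1#-homo hom) (IsRingHomomorphism.1#-homo hom))
  where open CommutativeRing B
chebyshev-hom A B hom x (suc zero)    = CommutativeRing.refl B
chebyshev-hom A B hom x (suc (suc n)) = trans (IsRingHomomorphism.+-homo hom _ _) (+-cong
  (trans (IsRingHomomorphism.*-homo hom _ _) (*-congˡ (chebyshev-hom A B hom x (suc n))))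
  (trans (IsRingHomomorphism.-‿homo hom _) (-‿cong (chebyshev-hom A B hom x n))))
  where open CommutativeRing B

-- With r = u + v and u v = 1, the n-th Chebyshev power of r is uⁿ + vⁿ.
chebyshev-sum : ∀ {c ℓ} (R : CommutativeRing c ℓ) → let open CommutativeRing R in
  ∀ {r u v} → r ≈ u + v → u * v ≈ 1# →
  ∀ n → chebyshevPower (CommutativeRing.rawRing R) r n ≈
        power (CommutativeRing.rawRing R) u n + power (CommutativeRing.rawRing R) v n
chebyshev-sum R r≈ uv≈1 zero       = CommutativeRing.refl R
chebyshev-sum R {r} {u} {v} r≈ uv≈1 (suc zero) = trans r≈ (+-cong (sym (*-identityʳ u)) (sym (*-identityʳ v)))
  where open CommutativeRing R
chebyshev-sum R {r} {u} {v} r≈ uv≈1 (suc (suc n)) = begin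
  r * chebyshevPower (CommutativeRing.rawRing R) r (suc n) - chebyshevPower (CommutativeRing.rawRing R) r n
    ≈⟨ +-cong (*-cong r≈ (chebyshev-sum R r≈ uv≈1 (suc n))) (-‿cong (chebyshev-sum R r≈ uv≈1 n)) ⟩
  (u + v) * (u * x + v * y) - (x + y)
    ≈⟨ solve 4 (λ u v x y → (u :+ v) :* (u :* x :+ v :* y) :- (x :+ y)
         := u :* (u :* x) :+ v :* (v :* y) :+ (u :* v :* (x :+ y) :- (x :+ y))) refl u v x y ⟩
  u * (u * x) + v * (v * y) + (u * v * (x + y) - (x + y))
    ≈⟨ +-congˡ (trans (+-congʳ (trans (*-congʳ uv≈1) (*-identityˡ _))) (-‿inverseʳ _)) ⟩
  u * (u * x) + v * (v * y) + 0#
    ≈⟨ +-identityʳ _ ⟩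
  u * (u * x) + v * (v * y) ∎
  where
  open CommutativeRing R
  open Solver R
  open import Relation.Binary.Reasoning.Setoid setoid
  x = power (CommutativeRing.rawRing R) u n
  y = power (CommutativeRing.rawRing R) v n

heytingRing : ∀ {c ℓ₁ ℓ₂} → HeytingField c ℓ₁ ℓ₂ → CommutativeRing c ℓ₁
heytingRing K = HeytingCommutativeRing.commutativeRing (HeytingField.heytingCommutativeRing K)

-- Ring homomorphisms from a Heyting field to a stable field.
infix 4 _⟶_
_⟶_ : ∀ {a ℓ₁ ℓ₂ b m} → HeytingField a ℓ₁ ℓ₂ → StableField b m → Set (a ⊔ ℓ₁ ⊔ b ⊔ m)
K ⟶ Ω = Σ[ φ ∈ (HeytingField.Carrier K → StableField.Carrier Ω) ]
  IsRingHomomorphism (rawRing K) (StableField.rawRing Ω) φ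

hom-injective : ∀ {a ℓ₁ ℓ₂ b m} (K : HeytingField a ℓ₁ ℓ₂) (Ω : StableField b m) (φ : K ⟶ Ω) →
  let open StableField Ω
      module K = StableField (stableField K)
  in
  ∀ {x} → proj₁ φ x ≈ 0# → x K.≈ K.0#
hom-injective K Ω (φ , hom) {x} φx≈0 = K.≈-stable λ x≉0 → K.inverse x x≉0 λ (y , xy≈1) → 1≉0 (begin
    1#                 ≈⟨ sym φ.1#-homo ⟩
    φ K.1#             ≈⟨ φ.⟦⟧-cong (K.sym xy≈1) ⟩
    φ (x K.* y)        ≈⟨ φ.*-homo x y ⟩
    φ x * φ y          ≈⟨ trans (*-congʳ φx≈0) (zeroˡ _) ⟩
    0#                 ∎)
  where
  open StableField Ω
  module K = StableField (stableField K)
  module φ = IsRingHomomorphism hom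
  open import Relation.Binary.Reasoning.Setoid setoid

-- The restriction of a homomorphism along a field extension.
restrict : ∀ {a ℓ₁ ℓ₂ a′ ℓ₁′ ℓ₂′ b m}
           {K : HeytingField a ℓ₁ ℓ₂} {L : HeytingField a′ ℓ₁′ ℓ₂′} {Ω : StableField b m} →
           Extension K L → L ⟶ Ω → K ⟶ Ω
restrict {Ω = Ω} E (φ , hom) = φ ∘ Extension.⟦_⟧ E , Composition.isRingHomomorphism (StableField.trans Ω)
  (RingMorphisms.IsRingMonomorphism.isRingHomomorphism (Extension.isRingMonomorphism E)) hom

-- Descent along a tower of extensions

module Towers {c ℓ₁} (ℓ₂ : Level) (Ω : StableField c ℓ₁)
  (pow : (R : RawRing c ℓ₁) → RawRing.Carrier R → ℕ → RawRing.Carrier R) where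

  -- The restriction of a homomorphism to the bottom of a tower.
  restrictTower : ∀ {K L : HeytingField c ℓ₁ ℓ₂} → Tower pow K L → L ⟶ Ω → K ⟶ Ω
  restrictTower []                    φ = φ
  restrictTower (_∷_ {L = M} s T) φ =
    restrict {L = M} {Ω = Ω} (RootAdjunction.extension s) (restrictTower T φ)

  restrictTower-embed : ∀ {K L} (T : Tower pow K L) (φ : L ⟶ Ω) x →
                        proj₁ (restrictTower T φ) x ≡ proj₁ φ (embed pow T x)
  restrictTower-embed []      φ x = ≡.refl
  restrictTower-embed (s ∷ T) φ x = restrictTower-embed T φ _

  -- The images of all generators of the tower satisfy Good.
  AllRoots : ∀ {K L : HeytingField c ℓ₁ ℓ₂} → (StableField.Carrier Ω → Set (c ⊔ ℓ₁)) →
             Tower pow K L → L ⟶ Ω → Set (c ⊔ ℓ₁)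
  AllRoots Good []      φ = Lift (c ⊔ ℓ₁) ⊤
  AllRoots Good (s ∷ T) φ = Good (proj₁ (restrictTower T φ) (RootAdjunction.r s)) × AllRoots Good T φ

-- r is of the form u + 1 / u.
InvertibleSum : ∀ {c ℓ} (Ω : StableField c ℓ) → StableField.Carrier Ω → Set (c ⊔ ℓ)
InvertibleSum Ω r = ∃[ u ] UnitSum Ω r u

-- The n-th multiple of the unit vanishes.
MultipleVanishes : ∀ {c ℓ} → StableField c ℓ → ℕ → Set ℓ
MultipleVanishes Ω n = Mult._×_ semiring n 1# ≈ 0#
  where open StableField Ω

module Descent {c ℓ} (Ω : StableField c ℓ) (s : Level) {p : ℕ} (prime : Prime p)
               (p·1≈0 : MultipleVanishes Ω p) where
  open StableField Ω hiding (zero; rawRing)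
  private Ωᴿ = StableField.rawRing Ω
  open LinearAlgebra Ω s
  open Adjunction Ω s
  open Radical Ω s
  open ArtinSchreier Ω s prime
  open Solver commutativeRing
  open Exp semiring using (^-congˡ)
  open import Relation.Binary.Reasoning.Setoid setoid

  -- A root of Xᵖ - X - t in S.
  Root : Subfield → Carrier → Set (c ⊔ ℓ ⊔ s)
  Root S t = Σ[ x ∈ Carrier ] S ∋ x × IsRoot t x

  -- S contains the image of φ.
  Image⊆ : ∀ {a ℓ₁ ℓ₂} {K : HeytingField a ℓ₁ ℓ₂} → K ⟶ Ω → Subfield → Set (a ⊔ c ⊔ ℓ ⊔ s)
  Image⊆ φ S = ∀ x → S ∋ proj₁ φ x

  adjoin-Image⊆ : ∀ {a ℓ₁ ℓ₂ a′ ℓ₁′ ℓ₂′} {K : HeytingField a ℓ₁ ℓ₂} {L : HeytingField a′ ℓ₁′ ℓ₂′}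
    (E : Extension K L) {r} → GeneratedBy E r → (φ : L ⟶ Ω) → ∀ S →
    Image⊆ {K = K} (restrict {L = L} {Ω = Ω} E φ) S → S ∋ proj₁ φ r → Image⊆ {K = L} φ S
  adjoin-Image⊆ E gen (φ , hom) S K⊆S r∈S x = go (gen x)
    where
    open Subfield S
    module φ = IsRingHomomorphism hom
    go : ∀ {x} → Adjoin E _ x → S ∋ φ x
    go (base x)       = K⊆S x
    go generator      = r∈S
    go (add x y)      = respects (sym (φ.+-homo _ _)) (plus (go x) (go y))
    go (neg x)        = respects (sym (φ.-‿homo _)) (negate (go x))
    go (mul x y)      = respects (sym (φ.*-homo _ _)) (times (go x) (go y))
    go (inv x xy≈1)   = recip (go x) (trans (sym (φ.*-homo _ _)) (trans (φ.⟦⟧-cong xy≈1) φ.1#-homo))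
    go (resp x≈y x)   = respects (φ.⟦⟧-cong x≈y) (go x)

  -- An extension of S in Ω in which Xᵖ - X - t has a root only if it has one in S.
  record Rootless (S : Subfield) (t : Carrier) : Set (lsuc (c ⊔ ℓ ⊔ s)) where
    field
      field′   : Subfield
      extends  : S ⊆ field′
      descend  : Root field′ t → ¬ ¬ Root S t

  radical-rootless : ∀ {S t r m} → RootsOfUnity S → S ∋ t → 0 ℕ.< m → S ∋ r ^ m →
                     Σ[ R ∈ Rootless S t ] Rootless.field′ R ∋ r
  radical-rootless {S} {t} {r} {m} μ⊆S t∈ 0<m r^m∈ = record
    { field′  = Integral.adjoin 0<m (radical-integral 0<m r^m∈)
    ; extends = λ x∈ → pure (ring-const x∈)
    ; descend = λ (x , x∈ , root) → x∈ >>= λ x∈ → radical-step p·1≈0 {S} μ⊆S t∈ m 0<m r^m∈ x∈ root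
    } , pure (2 , poly-var)

  Rootless-trans : ∀ {S t} (R : Rootless S t) → Rootless (Rootless.field′ R) t → Rootless S t
  Rootless-trans R R′ = record
    { field′  = Rootless.field′ R′
    ; extends = Rootless.extends R′ ∘ Rootless.extends R
    ; descend = λ root → Rootless.descend R′ root >>= Rootless.descend R
    }

  -- Descent along towers for a general notion of power.  The hypothesis step places every r that
  -- satisfies Good and has a power in S into an extension of S that creates no root.
  module _ {ℓ₂} (pow : (R : RawRing c ℓ) → RawRing.Carrier R → ℕ → RawRing.Carrier R)
           (Good : Carrier → Set (c ⊔ ℓ))
           (step : ∀ {S t r m} → RootsOfUnity S → S ∋ t → Good r → 0 ℕ.< m → S ∋ pow Ωᴿ r m →
                   Σ[ R ∈ Rootless S t ] Rootless.field′ R ∋ r)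
           (pow-hom : ∀ (K : HeytingField c ℓ ℓ₂) (φ : K ⟶ Ω) x n →
                      proj₁ φ (pow (rawRing K) x n) ≈ pow Ωᴿ (proj₁ φ x) n) where
    open Towers ℓ₂ Ω pow

    tower-descent : ∀ {K L} (T : Tower pow K L) (φ : L ⟶ Ω) → AllRoots Good T φ →
      ∀ {S t} → RootsOfUnity S → S ∋ t → Image⊆ {K = K} (restrictTower T φ) S →
      ∀ x → IsRoot t (proj₁ φ x) → ¬ ¬ Root S t
    tower-descent []      φ _ μ⊆S t∈ K⊆S x root = pure (proj₁ φ x , K⊆S x , root)
    tower-descent (_∷_ {L = M} s T) φ (good , goods) {S} μ⊆S t∈ K⊆S x root =
      tower-descent T φ goods {field′} (λ z n 0<n z^n≈1 → extends (μ⊆S z n 0<n z^n≈1)) (extends t∈)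
        (adjoin-Image⊆ {L = M} extension generatedBy ψ field′ (λ x → extends (K⊆S x)) r∈) x root >>= descend
      where
      open RootAdjunction s
      ψ = restrictTower T φ
      next = step {S} {m = m} μ⊆S t∈ good (ℕ.>-nonZero⁻¹ m ⦃ m-nonZero ⦄)
        (Subfield.respects S (trans (sym (IsRingHomomorphism.⟦⟧-cong (proj₂ ψ) pow-r)) (pow-hom M ψ r m)) (K⊆S radicand))
      open Rootless (proj₁ next)
      r∈ = proj₂ next

  -- With r = u + v, u v = 1 and a = uᵐ + vᵐ the m-th Chebyshev power of r, first adjoin the square
  -- root d = uᵐ - vᵐ of a² - 4, which gives uᵐ = (a + d) / 2, and then u.
  chebyshev-rootless : ¬ (1# + 1# ≈ 0#) → ∀ {S t r m} → RootsOfUnity S → S ∋ t → InvertibleSum Ω r →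
                       0 ℕ.< m → S ∋ chebyshevPower Ωᴿ r m →
                       Σ[ R ∈ Rootless S t ] Rootless.field′ R ∋ r
  chebyshev-rootless 2≉0 {S} {t} {r} {m} μ⊆S t∈ (u , u²+1≈ru) 0<m a∈ =
      Rootless-trans R₁ R₂ , Subfield.respects S₂ (sym r≈u+v) (Subfield.plus S₂ u∈ (Subfield.recip S₂ u∈ uv≈1))
    where
    v = r - u
    r≈u+v : r ≈ u + v
    r≈u+v = solve 2 (λ r u → r := u :+ (r :- u)) refl r u
    uv≈1 : u * v ≈ 1#
    uv≈1 = begin
      u * (r - u)           ≈⟨ solve 2 (λ r u → u :* (r :- u) := r :* u :- u :* u) refl r u ⟩
      r * u - u * u         ≈⟨ +-congʳ (sym u²+1≈ru) ⟩
      u * u + 1# - u * u    ≈⟨ solve 2 (λ u i → u :* u :+ i :- u :* u := i) refl u 1# ⟩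
      1#                    ∎
    a = chebyshevPower Ωᴿ r m
    U = u ^ m
    W = v ^ m
    a≈U+W : a ≈ U + W
    a≈U+W = chebyshev-sum commutativeRing r≈u+v uv≈1 m
    UW≈1 : U * W ≈ 1#
    UW≈1 = trans (sym (^-distrib-* u v m)) (trans (^-congˡ m uv≈1) (1^n≈1 m))
      where open CommutativeExp commutativeSemiring using (^-distrib-*)
    d = U - W
    four = (1# + 1#) * (1# + 1#)
    d²∈ : S ∋ d ^ 2
    d²∈ = Subfield.respects S (begin
      a * a - four                              ≈⟨ +-cong (*-cong a≈U+W a≈U+W)
                                                    (-‿cong (trans (sym (*-identityʳ _)) (*-congˡ (sym UW≈1)))) ⟩
      (U + W) * (U + W) - four * (U * W)        ≈⟨ +-congˡ (-‿cong fourfold) ⟩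
      (U + W) * (U + W) - (U * W + U * W + (U * W + U * W))
        ≈⟨ solve 2 (λ U W → (U :+ W) :* (U :+ W) :- (U :* W :+ U :* W :+ (U :* W :+ U :* W))
             := (U :- W) :* (U :- W)) refl U W ⟩
      d * d                                     ≈⟨ *-congˡ (sym (*-identityʳ d)) ⟩
      d ^ 2                                     ∎)
      (Subfield.plus S (Subfield.times S a∈ a∈) (Subfield.negate S
        (Subfield.times S two∈ two∈)))
      where
      two∈ = Subfield.plus S (Subfield.one S) (Subfield.one S)
      fourfold : four * (U * W) ≈ U * W + U * W + (U * W + U * W)
      fourfold = trans (solve 2 (λ i x → (i :+ i) :* (i :+ i) :* x
          := i :* (i :* x) :+ i :* (i :* x) :+ (i :* (i :* x) :+ i :* (i :* x))) refl 1# (U * W))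
        (+-cong (+-cong e e) (+-cong e e))
        where e = trans (*-identityˡ _) (*-identityˡ (U * W))
    step₁ = radical-rootless {S} {m = 2} μ⊆S t∈ ℕ.z<s d²∈
    R₁ = proj₁ step₁
    S₁ = Rootless.field′ R₁
    U∈ : S₁ ∋ u ^ m
    U∈ = cancelˡ {S₁} (Subfield.plus S₁ (Subfield.one S₁) (Subfield.one S₁)) 2≉0
      (Subfield.respects S₁ (begin
        a + (U - W)       ≈⟨ +-congʳ a≈U+W ⟩
        U + W + (U - W)   ≈⟨ solve 2 (λ U W → U :+ W :+ (U :- W) := U :+ U) refl U W ⟩
        U + U             ≈⟨ sym (+-cong (*-identityˡ U) (*-identityˡ U)) ⟩
        1# * U + 1# * U   ≈⟨ sym (distribʳ U 1# 1#) ⟩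
        (1# + 1#) * U     ∎)
        (Subfield.plus S₁ (Rootless.extends R₁ a∈) (proj₂ step₁)))
    step₂ = radical-rootless {S₁} {m = m} (λ z n 0<n z^n≈1 → Rootless.extends R₁ (μ⊆S z n 0<n z^n≈1))
      (Rootless.extends R₁ t∈) 0<m U∈
    R₂ = proj₁ step₂
    S₂ = Rootless.field′ R₂
    u∈ : S₂ ∋ u
    u∈ = proj₂ step₂

-- The Artin-Schreier polynomial over a field of rational functions

splits⇒root : ∀ {b m₁ m₂} {K L : HeytingField b m₁ m₂} {φ : HeytingField.Carrier K → HeytingField.Carrier L}
  (hom : IsRingHomomorphism (rawRing K) (rawRing L) φ) (p : ℕ) (t : HeytingField.Carrier K) →
  let open CommutativeRing (heytingRing L) hiding (rawRing)
      module K[X] = Polynomials (rawRing K)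
  in
  1 ℕ.< p → ¬ (power (rawRing L) (φ t) p ≈ φ t) →
  Polynomials.Splits (rawRing L) (map φ (K[X].X K[X].^ᴾ p K[X].-ᴾ K[X].X K[X].-ᴾ K[X].C t)) →
  Σ[ x ∈ Carrier ] power (rawRing L) x p ≈ x + φ t
splits⇒root {K = K} {L} {φ} hom p t 1<p t^p≉t (a , αs , P≈) = root αs P≈
  where
  open CommutativeRing (heytingRing L) hiding (rawRing)
  open Solver (heytingRing L)
  open import Relation.Binary.Reasoning.Setoid setoid
  module K[X] = Polynomials (rawRing K)
  open Polynomials (rawRing L)
  module L→L = Evaluation (heytingRing L) (heytingRing L)
  open Evaluation (heytingRing K) (heytingRing L)

  P : K[X].Poly
  P = K[X].X K[X].^ᴾ p K[X].-ᴾ K[X].X K[X].-ᴾ K[X].C t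

  idHom : IsRingHomomorphism (rawRing L) (rawRing L) id
  idHom = isRingHomomorphism (rawRing L) refl

  eval-id : ∀ f x → eval (map id f) x ≈ eval f x
  eval-id f x = reflexive (≡.cong (λ f → eval f x) (map-id f))

  linearFactors : List Carrier → Poly
  linearFactors αs = foldr _*ᴾ_ (C 1#) (map (λ α → X -ᴾ C α) αs)

  eval-P : ∀ αs → map φ P ≈ᴾ C a *ᴾ linearFactors αs → ∀ x →
           power (rawRing L) x p - x - φ t ≈ a * eval (linearFactors αs) x
  eval-P αs P≈ x = begin
    power (rawRing L) x p - x - φ t                 ≈⟨ sym (eval-artinSchreier hom x p t) ⟩
    eval (map φ P) x                            ≈⟨ eval-cong (map φ P) (C a *ᴾ linearFactors αs) P≈ x ⟩
    eval (C a *ᴾ linearFactors αs) x            ≈⟨ sym (eval-id (C a *ᴾ linearFactors αs) x) ⟩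
    eval (map id (C a *ᴾ linearFactors αs)) x   ≈⟨ L→L.eval-* idHom x (C a) (linearFactors αs) ⟩
    eval (map id (C a)) x * eval (map id (linearFactors αs)) x
      ≈⟨ *-cong (L→L.eval-C idHom x a) (eval-id (linearFactors αs) x) ⟩
    a * eval (linearFactors αs) x               ∎

  root : ∀ αs → map φ P ≈ᴾ C a *ᴾ linearFactors αs → Σ[ x ∈ Carrier ] power (rawRing L) x p ≈ x + φ t
  -- a constant would take the same value at 0 and at φ t
  root [] P≈ = contradiction (begin
      T ^p                          ≈⟨ solve 2 (λ f t → f := (f :- t :- t) :+ t :+ t) refl (T ^p) T ⟩
      T ^p - T - T + T + T          ≈⟨ +-congʳ (+-congʳ (trans (eval-P [] P≈ T) (trans
                                         (*-congˡ (+-congˡ (trans (zeroʳ T) (sym (zeroˡ _))))) (sym (eval-P [] P≈ 0#))))) ⟩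
      0# ^p - 0# - T + T + T        ≈⟨ +-congʳ (+-congʳ (+-congʳ (+-congʳ (0^ p 1<p)))) ⟩
      0# - 0# - T + T + T           ≈⟨ solve 2 (λ z t → z :- z :- t :+ t :+ t := t) refl 0# T ⟩
      T                             ∎) t^p≉t
    where
    T = φ t
    _^p = λ x → power (rawRing L) x p
    0^ : ∀ p → 1 ℕ.< p → power (rawRing L) 0# p ≈ 0#
    0^ (suc p) _ = zeroˡ _
  root (α ∷ αs) P≈ = α , (begin
    f                   ≈⟨ solve 3 (λ f x t → f := (f :- x :- t) :+ (x :+ t)) refl f α (φ t) ⟩
    f - α - φ t + (α + φ t) ≈⟨ +-congʳ (trans (eval-P (α ∷ αs) P≈ α) (trans (*-congˡ vanishes) (zeroʳ a))) ⟩
    0# + (α + φ t)      ≈⟨ +-identityˡ _ ⟩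
    α + φ t             ∎)
    where
    f = power (rawRing L) α p
    evalId : Poly → Carrier
    evalId = L→L.evalAt idHom α
    vanishes : eval (linearFactors (α ∷ αs)) α ≈ 0#
    vanishes = begin
      eval (linearFactors (α ∷ αs)) α          ≈⟨ sym (eval-id (linearFactors (α ∷ αs)) α) ⟩
      evalId ((X -ᴾ C α) *ᴾ linearFactors αs)  ≈⟨ L→L.eval-* idHom α (X -ᴾ C α) (linearFactors αs) ⟩
      evalId (X -ᴾ C α) * evalId (linearFactors αs) ≈⟨ *-congʳ (trans (L→L.eval-+ idHom α X (-ᴾ C α))
          (+-cong (L→L.eval-X idHom α) (trans (L→L.eval-neg idHom α (C α)) (-‿cong (L→L.eval-C idHom α α))))) ⟩
      (α - α) * evalId (linearFactors αs)      ≈⟨ trans (*-congʳ (-‿inverseʳ α)) (zeroˡ _) ⟩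
      0#                                       ∎

-- The image of F in a field over F(t), and its relation to the image T of t.
module BaseField {a ℓ₁ ℓ₂ b m₁ m₂} (F : HeytingField a ℓ₁ ℓ₂) (Fₜ : HeytingField b m₁ m₂)
                 (E : Extension F Fₜ) (t : HeytingField.Carrier Fₜ)
                 (Ω : StableField b m₁) (θ : Fₜ ⟶ Ω) where
  private
    module F = StableField (stableField F)
    module Fₜ = CommutativeRing (heytingRing Fₜ)
    module E = Extension E
    module F[X] = Polynomials (rawRing F)
    module Fₜ[X] = Polynomials (rawRing Fₜ)
    module θ = IsRingHomomorphism (proj₂ θ)
  open StableField Ω hiding (zero; rawRing)
  open LinearAlgebra Ω a
  open Adjunction Ω a
  open Transcendence Ω a
  open Solver commutativeRing
  open import Relation.Binary.Reasoning.Setoid setoid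

  ι : F ⟶ Ω
  ι = restrict {L = Fₜ} {Ω = Ω} E θ
  private module ι = IsRingHomomorphism (proj₂ ι)

  T : Carrier
  T = proj₁ θ t

  -- The image of F in Ω.
  image : Subfield
  image = record
    { member   = λ x → ¬ ¬ (∃[ y ] Lift b (proj₁ ι y ≈ x))
    ; respects = λ x≈x′ x∈ → x∈ >>= λ (y , lift eq) → pure (y , lift (trans eq x≈x′))
    ; stable   = λ x∈ → x∈ >>= id
    ; one      = pure (F.1# , lift ι.1#-homo)
    ; plus     = λ x∈ x′∈ → x∈ >>= λ (y , lift eq) → x′∈ >>= λ (y′ , lift eq′) →
        pure (y F.+ y′ , lift (trans (ι.+-homo y y′) (+-cong eq eq′)))
    ; times    = λ x∈ x′∈ → x∈ >>= λ (y , lift eq) → x′∈ >>= λ (y′ , lift eq′) →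
        pure (y F.* y′ , lift (trans (ι.*-homo y y′) (*-cong eq eq′)))
    ; negate   = λ x∈ → x∈ >>= λ (y , lift eq) → pure (F.- y , lift (trans (ι.-‿homo y) (-‿cong eq)))
    ; recip    = λ {x} {x′} x∈ xx′≈1 → x∈ >>= λ (y , lift eq) →
        F.inverse y (λ y≈0 → 1≉0 (begin
          1#       ≈⟨ sym xx′≈1 ⟩
          x * x′   ≈⟨ *-congʳ (trans (sym eq) (trans (ι.⟦⟧-cong y≈0) ι.0#-homo)) ⟩
          0# * x′  ≈⟨ zeroˡ x′ ⟩
          0#       ∎)) >>= λ (y′ , yy′≈1) → pure (y′ , lift (begin
            proj₁ ι y′              ≈⟨ sym (*-identityʳ _) ⟩
            proj₁ ι y′ * 1#         ≈⟨ *-congˡ (sym xx′≈1) ⟩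
            proj₁ ι y′ * (x * x′)   ≈⟨ *-congˡ (*-congʳ (sym eq)) ⟩
            proj₁ ι y′ * (proj₁ ι y * x′) ≈⟨ solve 3 (λ a b c → a :* (b :* c) := b :* a :* c) refl _ _ x′ ⟩
            proj₁ ι y * proj₁ ι y′ * x′ ≈⟨ *-congʳ (trans (sym (ι.*-homo y y′)) (trans (ι.⟦⟧-cong yy′≈1) ι.1#-homo)) ⟩
            1# * x′                 ≈⟨ *-identityˡ x′ ⟩
            x′                      ∎))
    }

  -- The value at T of a polynomial over F.
  value : F[X].Poly → Carrier
  value f = proj₁ θ (Fₜ[X].eval (map E.⟦_⟧ f) t)

  value-∷ : ∀ a f → value (a ∷ f) ≈ proj₁ ι a + T * value f
  value-∷ a f = trans (θ.+-homo _ _) (+-congˡ (θ.*-homo _ _))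

  value-snoc : ∀ f a → value (f ++ a ∷ []) ≈ proj₁ ι a * T ^ length f + value f
  value-snoc [] a = begin
    value (a ∷ [])                   ≈⟨ value-∷ a [] ⟩
    proj₁ ι a + T * proj₁ θ Fₜ.0#    ≈⟨ +-cong (sym (*-identityʳ _))
                                          (trans (*-congˡ θ.0#-homo) (trans (zeroʳ T) (sym θ.0#-homo))) ⟩
    proj₁ ι a * 1# + proj₁ θ Fₜ.0#   ∎
  value-snoc (b ∷ f) a = begin
    value (b ∷ f ++ a ∷ [])          ≈⟨ value-∷ b (f ++ a ∷ []) ⟩
    proj₁ ι b + T * value (f ++ a ∷ []) ≈⟨ +-congˡ (*-congˡ (value-snoc f a)) ⟩
    proj₁ ι b + T * (proj₁ ι a * T ^ length f + value f)
      ≈⟨ solve 5 (λ b t a s v → b :+ t :* (a :* s :+ v) := a :* (t :* s) :+ (b :+ t :* v)) refl (proj₁ ι b) T (proj₁ ι a) _ _ ⟩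
    proj₁ ι a * T ^ suc (length f) + (proj₁ ι b + T * value f) ≈⟨ +-congˡ (sym (value-∷ b f)) ⟩
    proj₁ ι a * T ^ suc (length f) + value (b ∷ f) ∎

  poly⇒polynomial : ∀ n {x} → Poly image T n x → ¬ ¬ (∃[ f ] length f ≡ n × value f ≈ x)
  poly⇒polynomial zero    (nil x≈0) = pure ([] , ≡.refl , trans θ.0#-homo (sym x≈0))
  poly⇒polynomial (suc n) (cons c∈ y∈ x≈) = c∈ >>= λ (c , lift ιc≈) → poly⇒polynomial n y∈ >>= λ where
    (f , ≡.refl , f≈y) → pure (f ++ c ∷ [] , ≡.trans (length-++ f) (ℕ.+-comm (length f) 1) ,
      trans (value-snoc f c) (trans (+-cong (*-congʳ ιc≈) f≈y) (sym x≈)))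

  coeff-snoc : ∀ f a → F[X].coeff (f ++ a ∷ []) (length f) ≡ a
  coeff-snoc []      a = ≡.refl
  coeff-snoc (b ∷ f) a = coeff-snoc f a

  transcendental : Transcendental E t → TranscendentalOver image T
  transcendental tr n {a} {y} a∈ y∈ eq = ≈-stable (a∈ >>= λ (c , lift ιc≈) → poly⇒polynomial n y∈ >>= λ where
    (f , ≡.refl , f≈y) → pure (trans (sym ιc≈) (trans (ι.⟦⟧-cong (F.trans (F.reflexive (≡.sym (coeff-snoc f c)))
      (tr (f ++ c ∷ []) (hom-injective Fₜ Ω θ (begin
        value (f ++ c ∷ [])               ≈⟨ value-snoc f c ⟩
        proj₁ ι c * T ^ length f + value f ≈⟨ +-cong (*-congʳ ιc≈) f≈y ⟩
        a * T ^ length f + y              ≈⟨ eq ⟩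
        0#                                ∎)) (length f)))) ι.0#-homo)))

module Insolvability {a ℓ₁ ℓ₂ b m₁ m₂} {p : ℕ} (prime : Prime p)
  (F : HeytingField a ℓ₁ ℓ₂) (char : HasCharacteristic F p)
  (Fₜ : HeytingField b m₁ m₂) (E : Extension F Fₜ) (t : HeytingField.Carrier Fₜ)
  (tr : Transcendental E t) (gen : GeneratedBy E t) where
  private
    module Fₜ[X] = Polynomials (rawRing Fₜ)

    P : Fₜ[X].Poly
    P = Fₜ[X].X Fₜ[X].^ᴾ p Fₜ[X].-ᴾ Fₜ[X].X Fₜ[X].-ᴾ Fₜ[X].C t

  multiple≈0 : ∀ {b m} (Ω : StableField b m) → F ⟶ Ω → ∀ n → p ∣ n → MultipleVanishes Ω n
  multiple≈0 Ω (φ , hom) n p∣n = trans (sym (multiple-hom (heytingRing F) commutativeRing hom n))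
      (trans (IsRingHomomorphism.⟦⟧-cong hom (Equivalence.from (char n) p∣n)) (IsRingHomomorphism.0#-homo hom))
    where open StableField Ω

  embed-hom : ∀ pow {K L : HeytingField b m₁ m₂} (T : Tower pow K L) →
              IsRingHomomorphism (rawRing K) (rawRing L) (embed pow T)
  embed-hom pow {K} []      = isRingHomomorphism (rawRing K) (CommutativeRing.refl (heytingRing K))
  embed-hom pow {K} {L} (s ∷ T) = Composition.isRingHomomorphism (CommutativeRing.trans (heytingRing L))
    (RingMorphisms.IsRingMonomorphism.isRingHomomorphism
      (Extension.isRingMonomorphism (RootAdjunction.extension s))) (embed-hom pow T)

  module _ (Ω : StableField b m₁) (pow : (R : RawRing b m₁) → RawRing.Carrier R → ℕ → RawRing.Carrier R)
           {L : HeytingField b m₁ m₂} (tower : Tower pow Fₜ L) (φ : L ⟶ Ω) where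
    open StableField Ω hiding (rawRing)
    open LinearAlgebra Ω a
    open Transcendence Ω a
    open Radical Ω a
    private
      θ : Fₜ ⟶ Ω
      θ = Towers.restrictTower m₂ Ω pow tower φ
    open BaseField F Fₜ E t Ω θ
    open Cyclotomic image

    -- The field of rational functions in t whose coefficients are generated by F and roots of unity.
    base-field : Subfield
    base-field = fractions cyclotomic T

    p·1≈0 : MultipleVanishes Ω p
    p·1≈0 = multiple≈0 Ω ι p (divides 1 (≡.sym (ℕ.*-identityˡ p)))

    open Descent Ω a prime p·1≈0

    base-unity : RootsOfUnity base-field
    base-unity z n 0<n z^n≈1 = fractions-const {cyclotomic} {T} (cyclotomic-unity z n 0<n z^n≈1)

    base-image : Image⊆ {K = Fₜ} θ base-field
    base-image = adjoin-Image⊆ {K = F} {L = Fₜ} E gen θ base-field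
      (λ x → fractions-const {cyclotomic} {T} (pure ([] , pure (x , lift refl)))) (fractions-var {cyclotomic} {T})

    base-rootless : ¬ Root base-field T
    base-rootless (x , x∈ , root) = Degree.no-root (cyclotomic-transcendental (transcendental tr)) p (prime>1 prime) x∈ root

    T^p≉T : ¬ (T ^ p ≈ T)
    T^p≉T T^p≈T = 1≉0 (transcendental tr p (Subfield.one image)
      (span-neg (poly-mono (prime>1 prime) (poly-var {image})))
      (trans (+-congʳ (trans (*-identityˡ _) T^p≈T)) (-‿inverseʳ T)))
      where open Adjunction Ω a

    -- A root of P in the top field would descend along the tower to the base field.
    insolvable : (Good : Carrier → Set (b ⊔ m₁)) →
      (∀ {S t r m} → RootsOfUnity S → S ∋ t → Good r → 0 ℕ.< m → S ∋ pow (StableField.rawRing Ω) r m →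
        Σ[ R ∈ Rootless S t ] Rootless.field′ R ∋ r) →
      (∀ (K : HeytingField b m₁ m₂) (φ : K ⟶ Ω) x n →
        proj₁ φ (pow (rawRing K) x n) ≈ pow (StableField.rawRing Ω) (proj₁ φ x) n) →
      Towers.AllRoots m₂ Ω pow Good tower φ →
      ¬ Polynomials.Splits (rawRing L) (map (embed pow tower) P)
    insolvable Good step pow-hom good splits = tower-descent pow Good step pow-hom tower φ good {base-field} {T}
        base-unity (fractions-var {cyclotomic} {T}) base-image (proj₁ root) root-image base-rootless
      where
      φ-power = power-hom (heytingRing L) commutativeRing (proj₂ φ)
      φt≈T : proj₁ φ (embed pow tower t) ≈ T
      φt≈T = reflexive (≡.sym (Towers.restrictTower-embed m₂ Ω pow tower φ t))
      root = splits⇒root {K = Fₜ} {L} (embed-hom pow tower) p t (prime>1 prime)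
        (λ t^p≈t → T^p≉T (trans (^-congˡ p (sym φt≈T)) (trans (sym (φ-power _ p))
          (trans (IsRingHomomorphism.⟦⟧-cong (proj₂ φ) t^p≈t) φt≈T)))) splits
        where open Exp semiring using (^-congˡ)
      root-image = trans (sym (φ-power _ p)) (trans (IsRingHomomorphism.⟦⟧-cong (proj₂ φ) (proj₂ root))
        (trans (IsRingHomomorphism.+-homo (proj₂ φ) _ _) (+-congˡ φt≈T)))

  not-solvable-in-radicals : ¬ SolvableInRadicals Fₜ P
  not-solvable-in-radicals (L , tower , splits) =
    insolvable (stableField L) power tower φ (λ _ → Lift (b ⊔ m₁) ⊤)
      (λ {S} {t} {r} {m} μ⊆S t∈ _ → radical-rootless {S} {t} {r} {m} μ⊆S t∈)
      (λ K φ → power-hom (heytingRing K) (heytingRing L) (proj₂ φ)) (trivial tower) splits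
    where
    φ : L ⟶ stableField L
    φ = id , isRingHomomorphism (rawRing L) (CommutativeRing.refl (heytingRing L))
    open Descent (stableField L) a prime (p·1≈0 (stableField L) power tower φ) using (radical-rootless)
    trivial : ∀ {K M} (T : Tower power K M) {φ : M ⟶ stableField L} →
              Towers.AllRoots m₂ (stableField L) power (λ _ → Lift (b ⊔ m₁) ⊤) T φ
    trivial []      = lift tt
    trivial (s ∷ T) = lift tt , trivial T

  map-sum : ∀ {Ω : StableField b m₁} {r} (X : RootExtension Ω r) → let open RootExtension X in
            ∀ {x} → InvertibleSum Ω x → InvertibleSum Ω′ (φ x)
  map-sum X (u , root) = φ u , trans (+-cong (sym (φ.*-homo u u)) (sym φ.1#-homo))
      (trans (sym (φ.+-homo _ _)) (trans (φ.⟦⟧-cong root) (φ.*-homo _ _)))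
    where
    open RootExtension X using (Ω′; φ; φ-hom)
    open StableField Ω′
    module φ = IsRingHomomorphism φ-hom

  extend-hom : ∀ {L : HeytingField b m₁ m₂} {Ω : StableField b m₁} {r} →
               L ⟶ Ω → (X : RootExtension Ω r) → L ⟶ RootExtension.Ω′ X
  extend-hom (φ , hom) X = RootExtension.φ X ∘ φ ,
    Composition.isRingHomomorphism (StableField.trans (RootExtension.Ω′ X)) hom (RootExtension.φ-hom X)

  module _ {Ω : StableField b m₁} {r} (X : RootExtension Ω r) where
    open RootExtension X using (Ω′)
    private
      module T = Towers m₂ Ω chebyshevPower
      module T′ = Towers m₂ Ω′ chebyshevPower

    extend-embed : ∀ {K L : HeytingField b m₁ m₂} (T : Tower chebyshevPower K L) (φ : L ⟶ Ω) x →
      RootExtension.φ X (proj₁ (T.restrictTower T φ) x) ≡ proj₁ (T′.restrictTower T (extend-hom {L = L} φ X)) x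
    extend-embed {L = L} T φ x = ≡.trans (≡.cong (RootExtension.φ X) (T.restrictTower-embed T φ x))
      (≡.sym (T′.restrictTower-embed T (extend-hom {L = L} φ X) x))

    extend-sums : ∀ {K L : HeytingField b m₁ m₂} (T : Tower chebyshevPower K L) (φ : L ⟶ Ω) →
      T.AllRoots (InvertibleSum Ω) T φ → T′.AllRoots (InvertibleSum Ω′) T (extend-hom {L = L} φ X)
    extend-sums []      φ _             = lift tt
    extend-sums (s ∷ T) φ (sum , sums) =
      ≡.subst (InvertibleSum Ω′) (extend-embed T φ _) (map-sum X sum) , extend-sums T φ sums

  -- Up to double negation, some field over the top of the tower contains, for every generator r of the
  -- tower, an element u with r = u + 1 / u.
  with-sums : ∀ {K L} (T : Tower chebyshevPower K L) →
    ¬ ¬ (Σ[ Ω ∈ StableField b m₁ ] Σ[ φ ∈ L ⟶ Ω ] Towers.AllRoots m₂ Ω chebyshevPower (InvertibleSum Ω) T φ)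
  with-sums {L = L} []      = pure (stableField L ,
    (id , isRingHomomorphism (rawRing L) (CommutativeRing.refl (heytingRing L))) , lift tt)
  with-sums {L = L} (s ∷ T) = with-sums T >>= λ (Ω , φ , sums) →
    rootExtension Ω (proj₁ (Towers.restrictTower m₂ Ω chebyshevPower T φ) (RootAdjunction.r s)) >>= λ X →
    pure (RootExtension.Ω′ X , extend-hom {L = L} φ X ,
      ≡.subst (InvertibleSum (RootExtension.Ω′ X)) (extend-embed X T φ _) (RootExtension.u X , RootExtension.u-root X) ,
      extend-sums X T φ sums)

  not-solvable-in-chebyshev-radicals : ¬ (2 ∣ p) → ¬ SolvableInChebyshevRadicals Fₜ P
  not-solvable-in-chebyshev-radicals 2∤p (L , tower , splits) = with-sums tower λ (Ω , φ , sums) →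
    let open Descent Ω a prime (p·1≈0 Ω chebyshevPower tower φ) using (chebyshev-rootless) in
    insolvable Ω chebyshevPower tower φ (InvertibleSum Ω)
      (λ {S} {τ} {r} {m} → chebyshev-rootless
        (2≉0 Ω (BaseField.ι F Fₜ E t Ω (Towers.restrictTower m₂ Ω chebyshevPower tower φ))) {S} {τ} {r} {m})
      (λ K φ → chebyshev-hom (heytingRing K) (StableField.commutativeRing Ω) (proj₂ φ)) sums splits
    where
    2≉0 : ∀ (Ω : StableField b m₁) → F ⟶ Ω → let open StableField Ω in ¬ (1# + 1# ≈ 0#)
    2≉0 Ω φ 2≈0 = 2∤p (≡.subst (2 ∣_) (ℕ.≤-antisym (prime>1 prime)
        (∣⇒≤ (Equivalence.to (char 2) (hom-injective F Ω φ (trans (multiple-hom (heytingRing F) commutativeRing (proj₂ φ) 2)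
          (trans (+-congˡ (+-identityʳ 1#)) 2≈0)))))) (divides 1 ≡.refl))
      where open StableField Ω

theorem74 : ∀ {a ℓ₁ ℓ₂ b m₁ m₂} (p : ℕ) → Prime p → ¬ (2 ∣ p) →
    (F : HeytingField a ℓ₁ ℓ₂) → HasCharacteristic F p →
    (F⟨t⟩ : HeytingField b m₁ m₂) (E : Extension F F⟨t⟩) (t : HeytingField.Carrier F⟨t⟩) →
    Transcendental E t → GeneratedBy E t →
    let open Polynomials (rawRing F⟨t⟩)
        P = X ^ᴾ p -ᴾ X -ᴾ C t
    in ¬ SolvableInRadicals F⟨t⟩ P × ¬ SolvableInChebyshevRadicals F⟨t⟩ P
theorem74 p p-prime 2∤p F char F⟨t⟩ E t transcendental generated =
    not-solvable-in-radicals , not-solvable-in-chebyshev-radicals 2∤p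
  where open Insolvability p-prime F char F⟨t⟩ E t transcendental generated
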